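{- Let $n=q_1q_2\cdots q_t$ be the factorization of an integer $n\ge 2$ as a product of powers of distinct primes, and let $q=\min\{q_i: i=1,\dots,t\}$. Then there exists a $(q-2)$-IPC$(n,n-1)$.
   Context: For permutations $\sigma,\tau$ of $[n]=\{1,\dots,n\}$, the Hamming distance is the number of $x$ with $\sigma(x)\neq\tau(x)$. A permutation code PC$(n,d)$ is a subset of $\mathcal{S}_n$ in which any two distinct elements are at Hamming distance at least $d$. A permutation code is idempotent if each of its words has exactly one fixed point. An $r$-IPC$(n,n-1)$ is an idempotent PC$(n,n-1)$ on $[n]$ in which every symbol $i\in[n]$ is the fixed point of exactly $r$ words. -}

module Defs where

open import Data.Nat using (ℕ; suc; _≤_; _^_; _∸_)
open import Data.Nat.Divisibility using (_∣_)
open import Data.Nat.Primality using (Prime)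
open import Data.Fin using (Fin; _≟_)
open import Data.Fin.Permutation using (Permutation′; _⟨$⟩ʳ_)
open import Data.List using (List; length; filter)
open import Data.List.Relation.Unary.AllPairs using (AllPairs)
open import Data.List.Relation.Unary.All using (All)
open import Data.List using (allFin)
open import Data.Product using (Σ; _×_)
open import Relation.Nullary using (¬_)
open import Relation.Nullary.Decidable using (¬?)
open import Relation.Binary.PropositionalEquality using (_≡_)

hamming : ∀ {n} → Permutation′ n → Permutation′ n → ℕ
hamming {n} σ τ = length (filter (λ x → ¬? ((σ ⟨$⟩ʳ x) ≟ (τ ⟨$⟩ʳ x))) (allFin n))

fixedPoints : ∀ {n} → Permutation′ n → List (Fin n)
fixedPoints {n} σ = filter (λ x → (σ ⟨$⟩ʳ x) ≟ x) (allFin n)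


-- A permutation code PC(n,d), given as a list of words: any two entries at
-- different positions of the list are at Hamming distance ≥ d.
-- (For d ≥ 1 this forces the entries to be distinct, so the list is a set.)
IsPC : (n d : ℕ) → List (Permutation′ n) → Set
IsPC n d C = AllPairs (λ σ τ → d ≤ hamming σ τ) C

IsIdempotent : ∀ {n} → List (Permutation′ n) → Set
IsIdempotent {n} C = All (λ σ → length (fixedPoints σ) ≡ 1) C

countFixing : ∀ {n} → List (Permutation′ n) → Fin n → ℕ
countFixing C i = length (filter (λ σ → (σ ⟨$⟩ʳ i) ≟ i) C)

IsRIPC : (r n : ℕ) → List (Permutation′ n) → Set
IsRIPC r n C = IsPC n (n ∸ 1) C × IsIdempotent C × (∀ (i : Fin n) → countFixing C i ≡ r)

IsPrimePowerFactor : ℕ → ℕ → Set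
IsPrimePowerFactor q n =
  Σ ℕ λ p → Σ ℕ λ k → Prime p × 1 ≤ k × q ≡ p ^ k × (p ^ k) ∣ n × ¬ ((p ^ suc k) ∣ n)

IsMinPrimePowerFactor : ℕ → ℕ → Set
IsMinPrimePowerFactor q n = IsPrimePowerFactor q n × (∀ q′ → IsPrimePowerFactor q′ n → q ≤ q′)

{-# OPTIONS --safe #-}

-- Over a product of fields F₁ × ⋯ × F_t with ∣F_i∣ = q_i, choose q − 2 elements
-- a_j whose components in every F_i are distinct and different from 0 and 1.
-- Then a_j, a_j − 1 and a_j − a_l are units, so the words x ↦ a_j x + b have a
-- unique fixed point and pairwise agree in at most one point.
--
-- A field with q = pᵏ elements is found as follows.  Put m = q − 1.  In the
-- finite rings obtained from ℤ/p by repeatedly passing from R to R[x]/(xᵐ − 1),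
-- every element satisfies a^q = a, because a ↦ a^q is additive.  After j < m
-- steps the previously adjoined roots u₁, …, u_j satisfy ∏(x − u_i) ≠ 0 in the
-- next ring, for degree reasons; hence after m steps the product of all
-- u_i − u_l is nonzero.  All powers aᵐ are idempotent, and a minimal idempotent e
-- below the m-th power of that product cuts out a residue field in which the u_i
-- are distinct.  Its nonzero elements are roots of xᵐ − 1, so they are the u_i.

module Submission where

open import Defs
open import Algebra using (CommutativeRing)
import Algebra.Properties.CommutativeSemigroup
import Algebra.Properties.CommutativeSemiring.Binomial
import Algebra.Properties.Ring
import Algebra.Properties.Semiring.Exp
import Algebra.Properties.Semiring.Mult
import Algebra.Properties.Semiring.Sum
open import Data.Bool using (if_then_else_)
open import Data.Fin as Fin using (Fin; zero; suc; toℕ; fromℕ; fromℕ<; inject₁; punchIn; punchOut)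
open import Data.Fin.Permutation using (Permutation′; _⟨$⟩ʳ_; permutation)
open import Data.Fin.Properties using (*↔×; all?; any?; inject≤-injective; punchIn-injective; punchInᵢ≢i; punchIn-punchOut; suc-injective; toℕ<n; toℕ-injective; toℕ-inject₁; toℕ-fromℕ; toℕ-fromℕ<)
open import Data.Integer as ℤ using (ℤ; +_; 0ℤ; 1ℤ)
open import Data.Integer.DivMod using (_%ℕ_; _/ℕ_; a≡a%ℕn+[a/ℕn]*n; n%ℕd<d)
import Data.Integer.Divisibility.Signed as ℤ
import Data.Integer.Properties as ℤ
open import Data.Integer.Solver using (module +-*-Solver)
open import Data.List using (List; []; _∷_; _++_; length; filter; map; upTo; allFin; cartesianProduct; cartesianProductWith)
open import Data.List.Membership.Propositional using (_∈_; find; lose)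
open import Data.List.Membership.Propositional.Properties using (∈-allFin; ∈-map⁺; ∈-upTo⁺; ∈-cartesianProductWith⁺)
open import Data.List.Properties using (filter-none; filter-accept; filter-reject; filter-++; length-++; length-tabulate)
open import Data.List.Relation.Unary.All as All using (All; []; _∷_)
import Data.List.Relation.Unary.All.Properties as All
open import Data.List.Relation.Unary.AllPairs as AllPairs using ([]; _∷_)
import Data.List.Relation.Unary.AllPairs.Properties as AllPairs
open import Data.List.Relation.Unary.Any as Any using (Any; here; there)
open import Data.List.Relation.Unary.Unique.Propositional using (Unique)
open import Data.List.Relation.Unary.Unique.Propositional.Properties using (allFin⁺; cartesianProduct⁺)
open import Data.Nat as ℕ using (ℕ; zero; suc; _≤_; _<_; _∸_; _!; z≤n; s≤s; NonZero)
open import Data.Nat.Combinatorics using (_C_; nCk≡n!/k![n-k]!; k![n∸k]!∣n!; nCn≡1; nCk≡nC[n∸k])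
open import Data.Nat.DivMod using (_%_; _mod_; m%n<n; m<n⇒m%n≡m; m*n%n≡0; m/n*n≡m; n%n≡0; %-distribˡ-+; [m+kn]%n≡m%n)
open import Data.Nat.Divisibility using (_∣_; _∤_; _∣?_; divides; 1∣_; ∣-refl; ∣-trans; ∣⇒≤; ∣1⇒≡1; m∣m*n; n∣m*n; *-monoʳ-∣; *-cancelˡ-∣)
open import Data.Nat.Induction using (<-rec)
open import Data.Nat.Primality using (Prime; euclidsLemma; prime⇒nonZero; prime⇒nonTrivial; prime⇒irreducible; ¬prime[1])
open import Data.Nat.Primality.Factorisation using (factorise)
open import Data.Nat.Properties as ℕ using (_!*_!≢0)
open import Data.Product using (Σ; ∃; _×_; _,_; proj₁; proj₂)
open import Data.Sum using (_⊎_; inj₁; inj₂)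
open import Data.Vec.Functional using () renaming (_∷_ to _◂_)
open import Function using (_∘_; _↔_; Inverse)
open import Function.Properties.Inverse using (↔-sym)
open import Level using (Level; 0ℓ)
open import Relation.Binary using (IsEquivalence)
open import Relation.Binary.PropositionalEquality as ≡ using (_≡_; _≢_)
import Relation.Binary.Reasoning.Setoid
open import Relation.Nullary using (¬_; Dec; does; yes; no; contradiction)
open import Relation.Nullary.Decidable using (¬?; dec-true; dec-false)
open import Relation.Unary using (Pred; Decidable)

-- Counting list entries that satisfy a predicate.

module _ {a p : Level} {A : Set a} {P : Pred A p} (P? : Decidable P) where

  length-filter-∁ : ∀ xs → length (filter P? xs) ℕ.+ length (filter (¬? ∘ P?) xs) ≡ length xs
  length-filter-∁ [] = ≡.refl
  length-filter-∁ (x ∷ xs) with P? x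
  ... | yes _ = ≡.cong suc (length-filter-∁ xs)
  ... | no  _ = ≡.trans (ℕ.+-suc (length (filter P? xs)) _) (≡.cong suc (length-filter-∁ xs))

  module _ (P-unique : ∀ {x y} → P x → P y → x ≡ y) where

    length-filter≤1 : ∀ {xs} → Unique xs → length (filter P? xs) ≤ 1
    length-filter≤1 [] = z≤n
    length-filter≤1 {x ∷ xs} (x∉xs ∷ uniq) with P? x
    ... | no _ = length-filter≤1 uniq
    ... | yes Px = s≤s (ℕ.≤-reflexive (≡.cong length
            (filter-none P? (All.map (λ x≢y Py → x≢y (P-unique Px Py)) x∉xs))))

    length-filter≡1 : ∀ {xs z} → Unique xs → z ∈ xs → P z → length (filter P? xs) ≡ 1
    length-filter≡1 {x ∷ xs} (x∉xs ∷ _) (here ≡.refl) Pz = ≡.trans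
      (≡.cong length (filter-accept P? Pz))
      (≡.cong (suc ∘ length) (filter-none P? (All.map (λ x≢y Py → x≢y (P-unique Pz Py)) x∉xs)))
    length-filter≡1 {x ∷ xs} (x∉xs ∷ uniq) (there z∈xs) Pz = ≡.trans
      (≡.cong length (filter-reject P? λ Px → All.lookup x∉xs z∈xs (P-unique Px Pz)))
      (length-filter≡1 uniq z∈xs Pz)

length-filter-map : ∀ {a b p} {A : Set a} {B : Set b} {P : Pred B p} (P? : Decidable P) (f : A → B) xs →
                    length (filter P? (map f xs)) ≡ length (filter (P? ∘ f) xs)
length-filter-map P? f [] = ≡.refl
length-filter-map P? f (x ∷ xs) with P? (f x)
... | yes _ = ≡.cong suc (length-filter-map P? f xs)
... | no  _ = length-filter-map P? f xs

-- The combinatorics of the words x ↦ a_j x + b over a ring, where every a_j,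
-- every a_j − 1 and every difference a_j − a_k with j ≢ k is a unit.
record AffineSystem (r : ℕ) (X : Set) : Set where
  field
    act             : Fin r → X → X → X
    act-injective   : ∀ j b {x y} → act j b x ≡ act j b y → x ≡ y
    act-surjective  : ∀ j b y → ∃ λ x → act j b x ≡ y
    shift-injective : ∀ j {b c} x → act j b x ≡ act j c x → b ≡ c
    agree-unique    : ∀ {j k} b c {x y} → j ≢ k → act j b x ≡ act k c x → act j b y ≡ act k c y → x ≡ y
    fixpoint        : ∀ j b → ∃ λ x → act j b x ≡ x
    fixpoint-unique : ∀ j b {x y} → act j b x ≡ x → act j b y ≡ y → x ≡ y
    fixing-shift    : ∀ j x → ∃ λ b → act j b x ≡ x

-- Transport, products and restriction of affine systems.

module _ {r : ℕ} {X Y : Set} where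
  open AffineSystem

  affineSystem-↔ : X ↔ Y → AffineSystem r X → AffineSystem r Y
  affineSystem-↔ X↔Y S = record
    { act             = λ j b x → to (act S j (from b) (from x))
    ; act-injective   = λ j b eq → from-inj (act-injective S j (from b) (to-inj eq))
    ; act-surjective  = λ j b y → let (x , eq) = act-surjective S j (from b) (from y) in
        to x , ≡.trans (≡.cong (to ∘ act S j (from b)) (from∘to x)) (≡.trans (≡.cong to eq) (to∘from y))
    ; shift-injective = λ j x eq → from-inj (shift-injective S j (from x) (to-inj eq))
    ; agree-unique    = λ b c j≢k eq₁ eq₂ →
        from-inj (agree-unique S (from b) (from c) j≢k (to-inj eq₁) (to-inj eq₂))
    ; fixpoint        = λ j b → let (x , eq) = fixpoint S j (from b) in
        to x , ≡.cong to (≡.trans (≡.cong (act S j (from b)) (from∘to x)) eq)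
    ; fixpoint-unique = λ j b eq₁ eq₂ → from-inj (fixpoint-unique S j (from b) (un eq₁) (un eq₂))
    ; fixing-shift    = λ j x → let (b , eq) = fixing-shift S j (from x) in
        to b , ≡.trans (≡.cong (λ c → to (act S j c (from x))) (from∘to b)) (≡.trans (≡.cong to eq) (to∘from x))
    }
    where
    open Inverse X↔Y using (to; from)
    to∘from : ∀ y → to (from y) ≡ y
    to∘from = Inverse.strictlyInverseˡ X↔Y
    from∘to : ∀ x → from (to x) ≡ x
    from∘to = Inverse.strictlyInverseʳ X↔Y
    to-inj : ∀ {x y} → to x ≡ to y → x ≡ y
    to-inj {x} {y} eq = ≡.trans (≡.sym (from∘to x)) (≡.trans (≡.cong from eq) (from∘to y))
    from-inj : ∀ {x y} → from x ≡ from y → x ≡ y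
    from-inj {x} {y} eq = ≡.trans (≡.sym (to∘from x)) (≡.trans (≡.cong to eq) (to∘from y))
    un : ∀ {x y} → to x ≡ y → x ≡ from y
    un {x} eq = ≡.trans (≡.sym (from∘to x)) (≡.cong from eq)

  -- Both factors share the index `j`. Slopes with different indices therefore differ in every
  -- component, as they must for their difference to be a unit of the product ring.
  affineSystem-× : AffineSystem r X → AffineSystem r Y → AffineSystem r (X × Y)
  affineSystem-× S T = record
    { act             = λ { j (b , b′) (x , x′) → act S j b x , act T j b′ x′ }
    ; act-injective   = λ { j (b , b′) eq →
        ≡.cong₂ _,_ (act-injective S j b (≡.cong proj₁ eq)) (act-injective T j b′ (≡.cong proj₂ eq)) }
    ; act-surjective  = λ { j (b , b′) (y , y′) →
        let (x , eq) = act-surjective S j b y ; (x′ , eq′) = act-surjective T j b′ y′ in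
        (x , x′) , ≡.cong₂ _,_ eq eq′ }
    ; shift-injective = λ { j (x , x′) eq →
        ≡.cong₂ _,_ (shift-injective S j x (≡.cong proj₁ eq)) (shift-injective T j x′ (≡.cong proj₂ eq)) }
    ; agree-unique    = λ { (b , b′) (c , c′) j≢k eq₁ eq₂ → ≡.cong₂ _,_
        (agree-unique S b c j≢k (≡.cong proj₁ eq₁) (≡.cong proj₁ eq₂))
        (agree-unique T b′ c′ j≢k (≡.cong proj₂ eq₁) (≡.cong proj₂ eq₂)) }
    ; fixpoint        = λ { j (b , b′) →
        let (x , eq) = fixpoint S j b ; (x′ , eq′) = fixpoint T j b′ in (x , x′) , ≡.cong₂ _,_ eq eq′ }
    ; fixpoint-unique = λ { j (b , b′) eq₁ eq₂ → ≡.cong₂ _,_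
        (fixpoint-unique S j b (≡.cong proj₁ eq₁) (≡.cong proj₁ eq₂))
        (fixpoint-unique T j b′ (≡.cong proj₂ eq₁) (≡.cong proj₂ eq₂)) }
    ; fixing-shift    = λ { j (x , x′) →
        let (b , eq) = fixing-shift S j x ; (b′ , eq′) = fixing-shift T j x′ in
        (b , b′) , ≡.cong₂ _,_ eq eq′ }
    }

affineSystem-* : ∀ {r m n} → AffineSystem r (Fin m) → AffineSystem r (Fin n) → AffineSystem r (Fin (m ℕ.* n))
affineSystem-* {m = m} {n} S T = affineSystem-↔ (↔-sym (*↔× {m} {n})) (affineSystem-× S T)

-- This is the zero ring. Its only element is a unit, so any number `r` of slopes is admissible and
-- it can start an induction over prime powers.
affineSystem-1 : ∀ {r} → AffineSystem r (Fin 1)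
affineSystem-1 = record
  { act             = λ _ _ x → x
  ; act-injective   = λ _ _ eq → eq
  ; act-surjective  = λ _ _ y → y , ≡.refl
  ; shift-injective = λ _ _ _ → all≡ _ _
  ; agree-unique    = λ _ _ _ _ _ → all≡ _ _
  ; fixpoint        = λ _ _ → Fin.zero , ≡.refl
  ; fixpoint-unique = λ _ _ _ _ → all≡ _ _
  ; fixing-shift    = λ _ _ → Fin.zero , ≡.refl
  }
  where
  all≡ : (x y : Fin 1) → x ≡ y
  all≡ Fin.zero Fin.zero = ≡.refl

-- Larger fields offer more slopes than the smallest one; discarding the surplus gives all factors a
-- common index set.
affineSystem-reindex : ∀ {r s X} (f : Fin s → Fin r) → (∀ {i j} → f i ≡ f j → i ≡ j) →
                       AffineSystem r X → AffineSystem s X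
affineSystem-reindex f f-inj S = record
  { act             = act ∘ f
  ; act-injective   = act-injective ∘ f
  ; act-surjective  = act-surjective ∘ f
  ; shift-injective = shift-injective ∘ f
  ; agree-unique    = λ b c j≢k → agree-unique b c (j≢k ∘ f-inj)
  ; fixpoint        = fixpoint ∘ f
  ; fixpoint-unique = fixpoint-unique ∘ f
  ; fixing-shift    = fixing-shift ∘ f
  }
  where open AffineSystem S

-- The permutation code of an affine system.

module _ {r n : ℕ} (S : AffineSystem r (Fin n)) where
  open AffineSystem S

  word : Fin r × Fin n → Permutation′ n
  word (j , b) = permutation (act j b) (λ y → proj₁ (act-surjective j b y))
    (λ y → proj₂ (act-surjective j b y))
    (λ x → act-injective j b (proj₂ (act-surjective j b (act j b x))))

  -- Two different words agree in at most one point. If their slopes differ this is `agree-unique`;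
  -- if the slopes coincide, a single agreement already forces equal shifts.
  hamming-word : ∀ w w′ → w ≢ w′ → n ∸ 1 ≤ hamming (word w) (word w′)
  hamming-word (j , b) (k , c) w≢w′ = begin
    n ∸ 1                                ≡⟨ ≡.cong (_∸ 1) (length-tabulate {n = n} (λ i → i)) ⟨
    length (allFin n) ∸ 1                ≡⟨ ≡.cong (_∸ 1) (length-filter-∁ agree? (allFin n)) ⟨
    length (filter agree? (allFin n)) ℕ.+ h ∸ 1
      ≤⟨ ℕ.∸-monoˡ-≤ 1 (ℕ.+-monoˡ-≤ h (length-filter≤1 agree? agree-≡ (allFin⁺ n))) ⟩
    h                                    ∎
    where
    open ℕ.≤-Reasoning
    agree? = λ x → act j b x Fin.≟ act k c x
    h = hamming (word (j , b)) (word (k , c))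
    agree-≡ : ∀ {x y} → act j b x ≡ act k c x → act j b y ≡ act k c y → x ≡ y
    agree-≡ {x} eq₁ eq₂ with j Fin.≟ k
    ... | no j≢k   = agree-unique b c j≢k eq₁ eq₂
    ... | yes ≡.refl = contradiction (≡.cong (j ,_) (shift-injective j x eq₁)) w≢w′

  code : List (Permutation′ n)
  code = map word (cartesianProduct (allFin r) (allFin n))

  -- For each slope, exactly one shift produces a word fixing `i`, so every slope contributes 1 to
  -- the count.
  length-fixing : ∀ i js → length (filter (λ w → (word w ⟨$⟩ʳ i) Fin.≟ i) (cartesianProduct js (allFin n))) ≡ length js
  length-fixing i [] = ≡.refl
  length-fixing i (j ∷ js) = begin
    length (filter P? (map (j ,_) (allFin n) ++ rest))
      ≡⟨ ≡.cong length (filter-++ P? (map (j ,_) (allFin n)) rest) ⟩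
    length (filter P? (map (j ,_) (allFin n)) ++ filter P? rest)
      ≡⟨ length-++ (filter P? (map (j ,_) (allFin n))) ⟩
    length (filter P? (map (j ,_) (allFin n))) ℕ.+ length (filter P? rest)
      ≡⟨ ≡.cong₂ ℕ._+_ fixing-j (length-fixing i js) ⟩
    suc (length js) ∎
    where
    open ≡.≡-Reasoning
    P? = λ (w : Fin r × Fin n) → (word w ⟨$⟩ʳ i) Fin.≟ i
    rest = cartesianProduct js (allFin n)
    fixing-j : length (filter P? (map (j ,_) (allFin n))) ≡ 1
    fixing-j = ≡.trans (length-filter-map P? (j ,_) (allFin n))
      (length-filter≡1 (λ b → act j b i Fin.≟ i) (λ eq₁ eq₂ → shift-injective j i (≡.trans eq₁ (≡.sym eq₂)))
        (allFin⁺ n) (∈-allFin _) (proj₂ (fixing-shift j i)))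

  code-isRIPC : IsRIPC r n code
  code-isRIPC =
      AllPairs.map⁺ (AllPairs.map (λ {w} {w′} → hamming-word w w′) (cartesianProduct⁺ (allFin⁺ r) (allFin⁺ n)))
    , All.map⁺ (All.universal (λ (j , b) → length-filter≡1 (λ x → act j b x Fin.≟ x) (fixpoint-unique j b)
        (allFin⁺ n) (∈-allFin _) (proj₂ (fixpoint j b))) _)
    , λ i → ≡.trans (length-filter-map (λ σ → (σ ⟨$⟩ʳ i) Fin.≟ i) word (cartesianProduct (allFin r) (allFin n)))
        (≡.trans (length-fixing i (allFin r)) (length-tabulate {n = r} (λ j → j)))

-- Splitting an integer into its prime power factors.

prime>1 : ∀ {p} → Prime p → 1 < p
prime>1 {p} pr = ℕ.nonTrivial⇒n>1 p {{prime⇒nonTrivial pr}}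

primeDivisor : ∀ n → 2 ≤ n → ∃ λ p → Prime p × p ∣ n
primeDivisor n@(suc _) 2≤n with factorise n
... | record { factors = [] ; isFactorisation = ≡.refl } = contradiction 2≤n λ { (s≤s ()) }
... | record { factors = p ∷ ps ; isFactorisation = eq ; factorsPrime = pr ∷ _ } =
  p , pr , ≡.subst (p ∣_) (≡.sym eq) (m∣m*n _)

primePart : ∀ {p} → Prime p → ∀ n → 1 ≤ n → ∃ λ k → ∃ λ n′ → n ≡ p ℕ.^ k ℕ.* n′ × p ∤ n′
primePart {p} pr = <-rec _ step
  where
  step : ∀ n → (∀ {n₁} → n₁ < n → 1 ≤ n₁ → ∃ λ k → ∃ λ n′ → n₁ ≡ p ℕ.^ k ℕ.* n′ × p ∤ n′) →
         1 ≤ n → ∃ λ k → ∃ λ n′ → n ≡ p ℕ.^ k ℕ.* n′ × p ∤ n′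
  step n rec 1≤n with p ∣? n
  ... | no p∤n = 0 , n , ≡.sym (ℕ.+-identityʳ n) , p∤n
  ... | yes (divides zero ≡.refl) = contradiction 1≤n λ ()
  ... | yes (divides n₁@(suc _) ≡.refl) with rec (ℕ.m<m*n n₁ p (prime>1 pr)) (s≤s z≤n)
  ...   | k , n′ , eq , p∤n′ = suc k , n′ , eq′ , p∤n′
    where
    eq′ : n₁ ℕ.* p ≡ p ℕ.^ suc k ℕ.* n′
    eq′ = ≡.trans (ℕ.*-comm n₁ p) (≡.trans (≡.cong (p ℕ.*_) eq) (≡.sym (ℕ.*-assoc p (p ℕ.^ k) n′)))

prime∣^ : ∀ {p m} → Prime p → ∀ k → p ∣ m ℕ.^ k → p ∣ m
prime∣^ pr zero    p∣1 = contradiction (≡.subst Prime (∣1⇒≡1 p∣1) pr) ¬prime[1]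
prime∣^ {m = m} pr (suc k) p∣ with euclidsLemma m (m ℕ.^ k) pr p∣
... | inj₁ p∣m = p∣m
... | inj₂ p∣  = prime∣^ pr k p∣

prime-∣-≡ : ∀ {p p′} → Prime p → Prime p′ → p ∣ p′ → p ≡ p′
prime-∣-≡ pr pr′ p∣p′ with prime⇒irreducible pr′ p∣p′
... | inj₁ ≡.refl = contradiction pr ¬prime[1]
... | inj₂ eq   = eq

-- Euclid's lemma moves one factor `p` at a time into `n`, since `p` never divides `m`.
^∣*⇒^∣ : ∀ {p m} → Prime p → p ∤ m → ∀ j n → p ℕ.^ j ∣ m ℕ.* n → p ℕ.^ j ∣ n
^∣*⇒^∣ pr p∤m zero n _ = 1∣ n
^∣*⇒^∣ {p} {m} pr p∤m (suc j) n p^∣ with euclidsLemma m n pr (∣-trans (m∣m*n (p ℕ.^ j)) p^∣)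
... | inj₁ p∣m = contradiction p∣m p∤m
... | inj₂ (divides n₁ ≡.refl) = ≡.subst (p ℕ.^ suc j ∣_) (ℕ.*-comm p n₁) (*-monoʳ-∣ p
        (^∣*⇒^∣ pr p∤m j n₁ (*-cancelˡ-∣ p {{prime⇒nonZero pr}} (≡.subst (p ℕ.^ suc j ∣_) eq p^∣))))
  where
  eq : m ℕ.* (n₁ ℕ.* p) ≡ p ℕ.* (m ℕ.* n₁)
  eq = ≡.trans (≡.sym (ℕ.*-assoc m n₁ p)) (ℕ.*-comm (m ℕ.* n₁) p)

module _ (primePower : ∀ p k → Prime p → 1 ≤ k → AffineSystem (p ℕ.^ k ∸ 2) (Fin (p ℕ.^ k))) (r : ℕ) where

  -- Strong induction: split off the full power `q` of one prime divisor, use the field of that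
  -- order for it, and recurse on the cofactor `n′`. The bound on `r` passes to `n′` because its
  -- prime power factors are also factors of `n`.
  affineSystem : ∀ n → 1 ≤ n → (∀ q → IsPrimePowerFactor q n → r ≤ q ∸ 2) → AffineSystem r (Fin n)
  affineSystem = <-rec _ step
    where
    step : ∀ n → (∀ {m} → m < n → 1 ≤ m → (∀ q → IsPrimePowerFactor q m → r ≤ q ∸ 2) → AffineSystem r (Fin m)) →
           1 ≤ n → (∀ q → IsPrimePowerFactor q n → r ≤ q ∸ 2) → AffineSystem r (Fin n)
    step 1 rec _ _ = affineSystem-1
    step n@(suc (suc _)) rec 1≤n bound with primeDivisor n (s≤s (s≤s z≤n))
    ... | p , pr , p∣n with primePart pr n 1≤n
    ...   | zero  , n′ , eq , p∤n′ = contradiction (≡.subst (p ∣_) (≡.trans eq (ℕ.+-identityʳ n′)) p∣n) p∤n′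
    ...   | suc k , zero , eq , p∤n′ = contradiction (≡.trans eq (ℕ.*-zeroʳ (p ℕ.^ suc k))) λ ()
    ...   | suc k , n′@(suc _) , eq , p∤n′ = ≡.subst (AffineSystem r ∘ Fin) (≡.sym eq)
            (affineSystem-*
              (affineSystem-reindex (λ i → Fin.inject≤ i r≤) (inject≤-injective r≤ r≤ _ _)
                (primePower p (suc k) pr (s≤s z≤n)))
              (rec n′<n (s≤s z≤n) bound′))
      where
      q = p ℕ.^ suc k
      instance
        p≢0 : NonZero p
        p≢0 = prime⇒nonZero pr
      r≤ : r ≤ q ∸ 2
      -- As `p` does not divide `n′`, no higher power of `p` than `q` divides `n`.
      r≤ = bound q (p , suc k , pr , s≤s z≤n , ≡.refl , ≡.subst (q ∣_) (≡.sym eq) (m∣m*n n′) ,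
        λ p^∣n → p∤n′ (*-cancelˡ-∣ q {{ℕ.m^n≢0 p (suc k)}} (≡.subst (_∣ q ℕ.* n′) (ℕ.*-comm p q) (≡.subst (p ℕ.^ suc (suc k) ∣_) eq p^∣n))))
      n′<n : n′ < n
      n′<n = ≡.subst (n′ <_) (≡.trans (ℕ.*-comm n′ q) (≡.sym eq))
        (ℕ.m<m*n n′ q (ℕ.<-≤-trans (prime>1 pr) (ℕ.m≤m*n p (p ℕ.^ k) {{ℕ.m^n≢0 p k}})))
      bound′ : ∀ q′ → IsPrimePowerFactor q′ n′ → r ≤ q′ ∸ 2
      bound′ q′ (p′ , j , pr′ , 1≤j , q′≡ , p′^j∣n′ , p′^∤n′) = bound q′
        -- A prime `p′` dividing `n′` differs from `p` and so does not divide `q`; hence a power of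
        -- `p′` dividing `n` already divides `n′`.
        (p′ , j , pr′ , 1≤j , q′≡ , ∣-trans p′^j∣n′ (≡.subst (n′ ∣_) (≡.sym eq) (n∣m*n q)) ,
         λ p′^∣n → p′^∤n′ (^∣*⇒^∣ pr′ p′∤q (suc j) n′ (≡.subst (p′ ℕ.^ suc j ∣_) eq p′^∣n)))
        where
        p′∣n′ : ∀ i → 1 ≤ i → p′ ℕ.^ i ∣ n′ → p′ ∣ n′
        p′∣n′ (suc i) _ = ∣-trans (m∣m*n (p′ ℕ.^ i))
        p′∤q : p′ ∤ q
        p′∤q p′∣q = p∤n′ (≡.subst (_∣ n′) (prime-∣-≡ pr′ pr (prime∣^ pr′ (suc k) p′∣q)) (p′∣n′ j 1≤j p′^j∣n′))

-- Affine systems from finite fields.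

record FiniteField (q : ℕ) : Set₁ where
  field
    commutativeRing : CommutativeRing 0ℓ 0ℓ
  open CommutativeRing commutativeRing public
  field
    0≉1           : ¬ 0# ≈ 1#
    inverse       : ∀ a → ¬ a ≈ 0# → ∃ λ b → b * a ≈ 1#
    -- The field is a setoid: `elt` and `index` express that it has exactly `q` classes modulo `≈`.
    elt           : Fin q → Carrier
    elt-injective : ∀ {i j} → elt i ≈ elt j → i ≡ j
    index         : Carrier → Fin q
    elt-index     : ∀ a → elt (index a) ≈ a

module _ {r : ℕ} (F : FiniteField (suc (suc r))) where
  open FiniteField F
  open Algebra.Properties.Ring ring
  open Relation.Binary.Reasoning.Setoid setoid

  index-injective : ∀ {a b} → index a ≡ index b → a ≈ b
  index-injective {a} {b} eq = trans (sym (elt-index a)) (trans (reflexive (≡.cong elt eq)) (elt-index b))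

  -- Every axiom about points is an intersection of two lines. Fixed points lie on the line of slope
  -- 1 and shift 0, and preimages of a value lie on a line of slope 0. This is why `slope-0` and
  -- `slope-1` speak of differences of slopes.
  intersection⇒ : ∀ {a a′} b c {x} → a * x + b ≈ a′ * x + c → (a - a′) * x ≈ c - b
  intersection⇒ {a} {a′} b c {x} eq = begin
    (a - a′) * x               ≈⟨ [y-z]x≈yx-zx x a a′ ⟩
    a * x - a′ * x             ≈⟨ +-congʳ (x≈z//y _ _ _ eq) ⟩
    (a′ * x + c - b) - a′ * x  ≈⟨ +-congʳ (+-assoc _ _ _) ⟩
    (a′ * x + (c - b)) - a′ * x ≈⟨ xyx⁻¹≈y (a′ * x) (c - b) ⟩
    c - b                      ∎

  intersection⇐ : ∀ {a a′} b c {x} → (a - a′) * x ≈ c - b → a * x + b ≈ a′ * x + c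
  intersection⇐ {a} {a′} b c {x} eq = begin
    a * x + b                        ≈⟨ +-congʳ (//-rightDividesˡ (a′ * x) (a * x)) ⟨
    (a * x - a′ * x) + a′ * x + b    ≈⟨ +-congʳ (+-congʳ ([y-z]x≈yx-zx x a a′)) ⟨
    (a - a′) * x + a′ * x + b        ≈⟨ +-congʳ (+-congʳ eq) ⟩
    (c - b) + a′ * x + b             ≈⟨ +-congʳ (+-comm _ _) ⟩
    a′ * x + (c - b) + b             ≈⟨ +-assoc _ _ _ ⟩
    a′ * x + ((c - b) + b)           ≈⟨ +-congˡ (//-rightDividesˡ b c) ⟩
    a′ * x + c                       ∎

  *-cancelˡ-unit : ∀ {a x y} → ¬ a ≈ 0# → a * x ≈ a * y → x ≈ y
  *-cancelˡ-unit {a} {x} {y} a≉0 eq with inverse a a≉0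
  ... | b , ba≈1 = begin
    x            ≈⟨ *-identityˡ x ⟨
    1# * x       ≈⟨ *-congʳ ba≈1 ⟨
    b * a * x    ≈⟨ *-assoc b a x ⟩
    b * (a * x)  ≈⟨ *-congˡ eq ⟩
    b * (a * y)  ≈⟨ *-assoc b a y ⟨
    b * a * y    ≈⟨ *-congʳ ba≈1 ⟩
    1# * y       ≈⟨ *-identityˡ y ⟩
    y            ∎

  solution : ∀ {a} c → ¬ a ≈ 0# → ∃ λ i → a * elt i ≈ c
  solution {a} c a≉0 with inverse a a≉0
  ... | b , ba≈1 = index (b * c) , (begin
    a * elt (index (b * c))  ≈⟨ *-congˡ (elt-index (b * c)) ⟩
    a * (b * c)              ≈⟨ *-assoc a b c ⟨
    a * b * c                ≈⟨ *-congʳ (trans (*-comm a b) ba≈1) ⟩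
    1# * c                   ≈⟨ *-identityˡ c ⟩
    c                        ∎)

  private
    index0≢index1 : index 0# ≢ index 1#
    index0≢index1 = 0≉1 ∘ index-injective

    -- The outer `punchIn` skips the index of 0, the inner one the position of the index of 1 among
    -- those left, so `r` = q - 2 slopes remain.
    slopeIndex : Fin r → Fin (suc (suc r))
    slopeIndex = punchIn (index 0#) ∘ punchIn (punchOut index0≢index1)

  slope : Fin r → Carrier
  slope = elt ∘ slopeIndex

  slope-0 : ∀ j → ¬ slope j - 0# ≈ 0#
  slope-0 j eq = punchInᵢ≢i (index 0#) _
    (elt-injective (trans (x∙y⁻¹≈ε⇒x≈y _ _ eq) (sym (elt-index 0#))))

  slope-1 : ∀ j → ¬ slope j - 1# ≈ 0#
  slope-1 j eq = punchInᵢ≢i (punchOut index0≢index1) j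
    (punchIn-injective (index 0#) _ _ (elt-injective (begin
      slope j                                              ≈⟨ x∙y⁻¹≈ε⇒x≈y _ _ eq ⟩
      1#                                                   ≈⟨ elt-index 1# ⟨
      elt (index 1#)                                       ≡⟨ ≡.cong elt (punchIn-punchOut index0≢index1) ⟨
      elt (punchIn (index 0#) (punchOut index0≢index1))    ∎)))

  slope-distinct : ∀ {j k} → j ≢ k → ¬ slope j - slope k ≈ 0#
  slope-distinct j≢k eq = j≢k (punchIn-injective (punchOut index0≢index1) _ _
    (punchIn-injective (index 0#) _ _ (elt-injective (x∙y⁻¹≈ε⇒x≈y _ _ eq))))

  fieldSystem : AffineSystem r (Fin (suc (suc r)))
  fieldSystem = record
    { act             = λ j b x → index (slope j * elt x + elt b)
    ; act-injective   = λ j b {x} {y} eq → elt-injective (*-cancelˡ-unit (slope-0 j) (trans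
        (intersection⇒ (elt b) _ (constant (index-injective eq)))
        (sym (intersection⇒ (elt b) _ (constant refl)))))
    ; act-surjective  = λ j b y → let (x , eq) = solution (elt y - elt b) (slope-0 j) in
        x , fromElt (trans (intersection⇐ (elt b) (elt y) eq) (trans (+-congʳ (zeroˡ _)) (+-identityˡ _)))
    ; shift-injective = λ j x eq → elt-injective (+-cancelˡ _ _ _ (index-injective eq))
    ; agree-unique    = λ b c j≢k eq₁ eq₂ → elt-injective (*-cancelˡ-unit (slope-distinct j≢k) (trans
        (intersection⇒ (elt b) (elt c) (index-injective eq₁))
        (sym (intersection⇒ (elt b) (elt c) (index-injective eq₂)))))
    ; fixpoint        = λ j b → let (x , eq) = solution (0# - elt b) (slope-1 j) in
        x , fromElt (trans (intersection⇐ (elt b) 0# eq) (trans (+-identityʳ _) (*-identityˡ _)))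
    ; fixpoint-unique = λ j b eq₁ eq₂ → elt-injective (*-cancelˡ-unit (slope-1 j) (trans
        (intersection⇒ (elt b) 0# (identity (toElt eq₁)))
        (sym (intersection⇒ (elt b) 0# (identity (toElt eq₂))))))
    ; fixing-shift    = λ j x → index (elt x - slope j * elt x) , fromElt (trans
        (+-congˡ (elt-index _)) (trans (+-comm _ _) (//-rightDividesˡ _ _)))
    }
    where
    constant : ∀ {x y z} → x ≈ y → x ≈ 0# * z + y
    constant eq = trans eq (sym (trans (+-congʳ (zeroˡ _)) (+-identityˡ _)))
    identity : ∀ {x y} → y ≈ x → y ≈ 1# * x + 0#
    identity eq = trans eq (sym (trans (+-identityʳ _) (*-identityˡ _)))
    toElt : ∀ {a i} → index a ≡ i → a ≈ elt i
    toElt ≡.refl = sym (elt-index _)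
    fromElt : ∀ {a i} → a ≈ elt i → index a ≡ i
    fromElt eq = elt-injective (trans (elt-index _) eq)

-- Binomial coefficients and the Frobenius map in characteristic `p`.

prime∣!⇒≤ : ∀ {p} → Prime p → ∀ k → p ∣ k ! → p ≤ k
prime∣!⇒≤ pr zero p∣1 = contradiction (≡.subst Prime (∣1⇒≡1 p∣1) pr) ¬prime[1]
prime∣!⇒≤ pr (suc k) p∣ with euclidsLemma (suc k) (k !) pr p∣
... | inj₁ p∣k  = ∣⇒≤ p∣k
... | inj₂ p∣k! = ℕ.m≤n⇒m≤1+n (prime∣!⇒≤ pr k p∣k!)

-- The prime `p` divides p! = C · k! · (p - k)!, but neither factorial, both being products of
-- numbers below `p`.
prime∣C : ∀ {p k} → Prime p → 0 < k → k < p → p ∣ p C k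
prime∣C {p@(suc p′)} {k@(suc k′)} pr 0<k k<p
  with euclidsLemma (p C k) (k ! ℕ.* (p ∸ k) !) pr (≡.subst (p ∣_) (≡.sym C*k!≡p!) (m∣m*n (p′ !)))
  where
  instance _ = k !* (p ∸ k) !≢0
  C*k!≡p! : (p C k) ℕ.* (k ! ℕ.* (p ∸ k) !) ≡ p !
  C*k!≡p! = ≡.trans (≡.cong (ℕ._* (k ! ℕ.* (p ∸ k) !)) (nCk≡n!/k![n-k]! (ℕ.<⇒≤ k<p)))
    (m/n*n≡m (k![n∸k]!∣n! (ℕ.<⇒≤ k<p)))
... | inj₁ p∣C = p∣C
... | inj₂ p∣k! with euclidsLemma (k !) ((p ∸ k) !) pr p∣k!
...   | inj₁ p∣ = contradiction (prime∣!⇒≤ pr k p∣) (ℕ.<⇒≱ k<p)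
...   | inj₂ p∣ = contradiction (prime∣!⇒≤ pr (p ∸ k) p∣) (ℕ.<⇒≱ (s≤s (ℕ.m∸n≤m p′ k′)))

module _ (R : CommutativeRing 0ℓ 0ℓ) where
  open CommutativeRing R hiding (zero)
  open Algebra.Properties.Semiring.Exp semiring using (_^_)
  open Algebra.Properties.Semiring.Sum semiring using (sum; sum-cong-≋; sum-replicate-zero)

  1^n≈1 : ∀ n → 1# ^ n ≈ 1#
  1^n≈1 zero    = refl
  1^n≈1 (suc n) = trans (*-identityˡ _) (1^n≈1 n)

  0^n≈0 : ∀ n .{{_ : NonZero n}} → 0# ^ n ≈ 0#
  0^n≈0 (suc n) = zeroˡ _

  sum-zero : ∀ {n} {f : Fin n → Carrier} → (∀ i → f i ≈ 0#) → sum f ≈ 0#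
  sum-zero {n} f≈0 = trans (sum-cong-≋ f≈0) (sum-replicate-zero n)

_×1≈0-in_ : ℕ → CommutativeRing 0ℓ 0ℓ → Set
p ×1≈0-in R = p · 1# ≈ 0#
  where
  open CommutativeRing R
  open Algebra.Properties.Semiring.Mult semiring renaming (_×_ to _·_)

module Frobenius (R : CommutativeRing 0ℓ 0ℓ) (p : ℕ) (pr : Prime p) (char : p ×1≈0-in R) where

  open CommutativeRing R hiding (zero)
  open Algebra.Properties.Semiring.Mult semiring renaming (_×_ to _·_)
  open Algebra.Properties.Semiring.Exp semiring
  open Algebra.Properties.Semiring.Sum semiring
  open Algebra.Properties.CommutativeSemiring.Binomial commutativeSemiring
  open Relation.Binary.Reasoning.Setoid setoid

  char∣⇒×≈0 : ∀ {n} → p ∣ n → ∀ x → n · x ≈ 0#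
  char∣⇒×≈0 (divides m ≡.refl) x = begin
    (m ℕ.* p) · x     ≈⟨ ×-assocˡ x m p ⟨
    m · (p · x)       ≈⟨ ×-congʳ m (begin
      p · x             ≈⟨ ×-congʳ p (*-identityˡ x) ⟨
      p · (1# * x)      ≈⟨ ×-assoc-* p 1# x ⟨
      (p · 1#) * x      ≈⟨ *-congʳ char ⟩
      0# * x            ≈⟨ zeroˡ x ⟩
      0#                ∎) ⟩
    m · 0#            ≈⟨ n×0≈0 m ⟩
    0#                ∎
    where
    n×0≈0 : ∀ n → n · 0# ≈ 0#
    n×0≈0 zero    = refl
    n×0≈0 (suc n) = trans (+-identityˡ _) (n×0≈0 n)

  -- Only the two outer terms of the binomial expansion survive, because `p` divides every inner
  -- coefficient.
  frobenius-+ : ∀ x y → (x + y) ^ p ≈ x ^ p + y ^ p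
  frobenius-+ x y = go p ≡.refl
    where
    -- The auxiliary `n` allows matching on a successor although `p` is a module parameter.
    go : ∀ n → n ≡ p → (x + y) ^ n ≈ x ^ n + y ^ n
    go zero eq = contradiction (≡.subst (1 <_) (≡.sym eq) (prime>1 pr)) λ ()
    go n@(suc n′) ≡.refl = begin
      (x + y) ^ n                                     ≈⟨ theorem n x y ⟩
      t zero + sum (t ∘ suc)                          ≈⟨ +-congˡ (sum-init-last (t ∘ suc)) ⟩
      t zero + (sum (λ i → t (suc (inject₁ i))) + t (suc (fromℕ n′)))
        ≈⟨ +-cong t-first (+-cong (sum-zero R t-middle) t-last) ⟩
      y ^ n + (0# + x ^ n)                            ≈⟨ +-congˡ (+-identityˡ _) ⟩
      y ^ n + x ^ n                                   ≈⟨ +-comm _ _ ⟩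
      x ^ n + y ^ n                                   ∎
      where
      t = binomialTerm x y n
      t-first : t zero ≈ y ^ n
      t-first = begin
        (n C 0) · (1# * y ^ n)  ≈⟨ ×-congˡ (≡.trans (nCk≡nC[n∸k] {0} {n} z≤n) (nCn≡1 n)) ⟩
        1 · (1# * y ^ n)        ≈⟨ ×-homo-1 _ ⟩
        1# * y ^ n              ≈⟨ *-identityˡ _ ⟩
        y ^ n                   ∎
      t-last : t (suc (fromℕ n′)) ≈ x ^ n
      t-last rewrite toℕ-fromℕ n′ = begin
        (n C n) · (x ^ n * y ^ (n ∸ n))  ≈⟨ ×-congˡ (nCn≡1 n) ⟩
        1 · (x ^ n * y ^ (n ∸ n))        ≈⟨ ×-homo-1 _ ⟩
        x ^ n * y ^ (n ∸ n)              ≈⟨ *-congˡ (^-congʳ y (ℕ.n∸n≡0 n)) ⟩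
        x ^ n * 1#                       ≈⟨ *-identityʳ _ ⟩
        x ^ n                            ∎
      t-middle : ∀ i → t (suc (inject₁ i)) ≈ 0#
      t-middle i = char∣⇒×≈0 (prime∣C pr (s≤s z≤n)
        (s≤s (≡.subst (_< n′) (≡.sym (toℕ-inject₁ i)) (toℕ<n i)))) _

  frobenius^-+ : ∀ k x y → (x + y) ^ (p ℕ.^ k) ≈ x ^ (p ℕ.^ k) + y ^ (p ℕ.^ k)
  frobenius^-+ zero x y = trans (*-identityʳ _) (sym (+-cong (*-identityʳ x) (*-identityʳ y)))
  frobenius^-+ (suc k) x y = begin
    (x + y) ^ (p ℕ.* q)        ≈⟨ ^-assocʳ (x + y) p q ⟨
    ((x + y) ^ p) ^ q          ≈⟨ ^-congˡ q (frobenius-+ x y) ⟩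
    (x ^ p + y ^ p) ^ q        ≈⟨ frobenius^-+ k (x ^ p) (y ^ p) ⟩
    (x ^ p) ^ q + (y ^ p) ^ q  ≈⟨ +-cong (^-assocʳ x p q) (^-assocʳ y p q) ⟩
    x ^ (p ℕ.* q) + y ^ (p ℕ.* q) ∎
    where q = p ℕ.^ k

  frobenius^-sum : ∀ k {n} (f : Fin n → Carrier) → sum f ^ (p ℕ.^ k) ≈ sum (λ i → f i ^ (p ℕ.^ k))
  frobenius^-sum k {zero} f = 0^n≈0 R (p ℕ.^ k) {{ℕ.m^n≢0 p k {{prime⇒nonZero pr}}}}
  frobenius^-sum k {suc n} f = trans (frobenius^-+ k (f zero) (sum (f ∘ suc))) (+-congˡ (frobenius^-sum k (f ∘ suc)))

-- The cyclic group ℤ/m and its group algebra.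

module CyclicGroup (m : ℕ) .{{_ : NonZero m}} where

  infixl 6 _⊕_

  _⊕_ : Fin m → Fin m → Fin m
  a ⊕ b = (toℕ a ℕ.+ toℕ b) mod m

  toℕ-mod : ∀ i → toℕ (i mod m) ≡ i % m
  toℕ-mod i = toℕ-fromℕ< (m%n<n i m)

  mod-≡ : ∀ {i j} → i % m ≡ j % m → i mod m ≡ j mod m
  mod-≡ {i} {j} eq = toℕ-injective (≡.trans (toℕ-mod i) (≡.trans eq (≡.sym (toℕ-mod j))))

  toℕ-mod-inverse : ∀ a → toℕ a mod m ≡ a
  toℕ-mod-inverse a = toℕ-injective (≡.trans (toℕ-mod (toℕ a)) (m<n⇒m%n≡m (toℕ<n a)))

  mod-⊕ : ∀ i j → (i mod m) ⊕ (j mod m) ≡ (i ℕ.+ j) mod m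
  mod-⊕ i j = mod-≡ (≡.trans
    (≡.cong₂ (λ s t → (s ℕ.+ t) % m) (toℕ-mod i) (toℕ-mod j)) (≡.sym (%-distribˡ-+ i j m)))

  ⊕-comm : ∀ a b → a ⊕ b ≡ b ⊕ a
  ⊕-comm a b = ≡.cong (_mod m) (ℕ.+-comm (toℕ a) (toℕ b))

  -- Associativity in cyclic form, as required by the rotation argument in `*ᴬ-assoc`.
  ⊕-rotate : ∀ a b c → a ⊕ b ⊕ c ≡ b ⊕ c ⊕ a
  ⊕-rotate a b c = ≡.trans (reduce a b c) (≡.trans
    (≡.cong (_mod m) (≡.trans (ℕ.+-assoc (toℕ a) (toℕ b) (toℕ c)) (ℕ.+-comm (toℕ a) _)))
    (≡.sym (reduce b c a)))
    where
    reduce : ∀ a b c → a ⊕ b ⊕ c ≡ (toℕ a ℕ.+ toℕ b ℕ.+ toℕ c) mod m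
    reduce a b c = ≡.trans (≡.cong (a ⊕ b ⊕_) (≡.sym (toℕ-mod-inverse c))) (mod-⊕ (toℕ a ℕ.+ toℕ b) (toℕ c))

  0⊕ : ∀ a → (0 mod m) ⊕ a ≡ a
  0⊕ a = ≡.trans (≡.cong ((0 mod m) ⊕_) (≡.sym (toℕ-mod-inverse a)))
    (≡.trans (mod-⊕ 0 (toℕ a)) (toℕ-mod-inverse a))

  -- Adding 1 can wrap around only to 0, which the successor `d` excludes.
  1⊕≡⇒ : ∀ {a d e} → toℕ d ≡ suc e → (1 mod m) ⊕ a ≡ d → toℕ a ≡ e
  1⊕≡⇒ {a} {d} {e} d≡1+e eq with ℕ.m≤n⇒m<n∨m≡n (toℕ<n a)
  ... | inj₁ 1+a<m = ℕ.suc-injective (≡.trans (≡.sym (m<n⇒m%n≡m 1+a<m)) 1+a≡)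
    where
    1+a≡ : suc (toℕ a) % m ≡ suc e
    1+a≡ = ≡.trans (≡.sym (toℕ-mod (suc (toℕ a)))) (≡.trans (≡.cong toℕ
      (≡.trans (≡.sym (mod-⊕ 1 (toℕ a))) (≡.trans (≡.cong ((1 mod m) ⊕_) (toℕ-mod-inverse a)) eq))) d≡1+e)
  ... | inj₂ 1+a≡m = contradiction (≡.trans (≡.sym d≡1+e) (≡.trans (≡.cong toℕ (≡.sym eq))
          (≡.trans (≡.cong toℕ (≡.trans (≡.cong ((1 mod m) ⊕_) (≡.sym (toℕ-mod-inverse a))) (mod-⊕ 1 (toℕ a))))
          (≡.trans (toℕ-mod (suc (toℕ a))) (≡.trans (≡.cong (_% m) 1+a≡m) (n%n≡0 m)))))) λ ()

-- R[x]/(xᵐ − 1): an element is the function giving its coefficient at each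
-- xⁱ, i < m.
module GroupAlgebra (R : CommutativeRing 0ℓ 0ℓ) (m : ℕ) .{{_ : NonZero m}} where

  open CommutativeRing R hiding (zero)
  open Algebra.Properties.Semiring.Sum semiring
  open Relation.Binary.Reasoning.Setoid setoid
  open CyclicGroup m

  -- Branching on `does` makes `δ (suc i) (suc j)` reduce to `δ i j`, so the induction in `sum-δ`
  -- goes through by computation.
  δ : ∀ {n} → Fin n → Fin n → Carrier
  δ i j = if does (i Fin.≟ j) then 1# else 0#

  δ-≡ : ∀ {n} {i j : Fin n} → i ≡ j → δ i j ≈ 1#
  δ-≡ {i = i} {j} i≡j rewrite dec-true (i Fin.≟ j) i≡j = refl

  δ-≢ : ∀ {n} {i j : Fin n} → i ≢ j → δ i j ≈ 0#
  δ-≢ {i = i} {j} i≢j rewrite dec-false (i Fin.≟ j) i≢j = refl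

  sum-δ : ∀ {n} (i : Fin n) (φ : Fin n → Carrier) → sum (λ j → δ i j * φ j) ≈ φ i
  sum-δ zero    φ = trans (+-cong (*-identityˡ _) (sum-zero R λ j → zeroˡ (φ (suc j)))) (+-identityʳ _)
  sum-δ (suc i) φ = trans (+-cong (zeroˡ _) (sum-δ i (φ ∘ suc))) (+-identityˡ _)

  A : Set
  A = Fin m → Carrier

  infix  4 _≈ᴬ_
  infixl 7 _*ᴬ_

  _≈ᴬ_ : A → A → Set
  f ≈ᴬ g = ∀ d → f d ≈ g d

  -- Cyclic convolution. Selecting the pairs by `δ` avoids subtraction in the index group and keeps
  -- the two factors symmetric.
  _*ᴬ_ : A → A → A
  (f *ᴬ g) d = sum λ a → sum λ b → f a * g b * δ (a ⊕ b) d

  monomial : ℕ → Carrier → A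
  monomial i c d = c * δ (i mod m) d

  *ᴬ-cong : ∀ {f f′ g g′} → f ≈ᴬ f′ → g ≈ᴬ g′ → f *ᴬ g ≈ᴬ f′ *ᴬ g′
  *ᴬ-cong f≈ g≈ d = sum-cong-≋ λ a → sum-cong-≋ λ b → *-congʳ (*-cong (f≈ a) (g≈ b))

  *ᴬ-comm : ∀ f g → f *ᴬ g ≈ᴬ g *ᴬ f
  *ᴬ-comm f g d = trans (∑-comm λ a b → f a * g b * δ (a ⊕ b) d)
    (sum-cong-≋ λ b → sum-cong-≋ λ a → *-cong (*-comm (f a) (g b)) (reflexive (≡.cong (λ i → δ i d) (⊕-comm a b))))

  -- View `φ` as the linear functional with value `φ i` at the i-th power of x; it is evaluated on a
  -- product by bilinearity.
  sum-*ᴬ : ∀ (f g φ : A) → sum (λ d → (f *ᴬ g) d * φ d) ≈ sum λ a → sum λ b → f a * g b * φ (a ⊕ b)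
  sum-*ᴬ f g φ = begin
    (sum λ d → (f *ᴬ g) d * φ d)
      ≈⟨ sum-cong-≋ (λ d → trans (*-distribʳ-sum (φ d) λ a → sum λ b → f a * g b * δ (a ⊕ b) d)
           (sum-cong-≋ λ a → *-distribʳ-sum (φ d) λ b → f a * g b * δ (a ⊕ b) d)) ⟩
    (sum λ d → sum λ a → sum λ b → f a * g b * δ (a ⊕ b) d * φ d)
      ≈⟨ ∑-comm (λ d a → sum λ b → f a * g b * δ (a ⊕ b) d * φ d) ⟩
    (sum λ a → sum λ d → sum λ b → f a * g b * δ (a ⊕ b) d * φ d)
      ≈⟨ sum-cong-≋ (λ a → ∑-comm λ d b → f a * g b * δ (a ⊕ b) d * φ d) ⟩
    (sum λ a → sum λ b → sum λ d → f a * g b * δ (a ⊕ b) d * φ d)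
      ≈⟨ sum-cong-≋ (λ a → sum-cong-≋ λ b → begin
           (sum λ d → f a * g b * δ (a ⊕ b) d * φ d)    ≈⟨ sum-cong-≋ (λ d → *-assoc (f a * g b) (δ (a ⊕ b) d) (φ d)) ⟩
           (sum λ d → f a * g b * (δ (a ⊕ b) d * φ d))  ≈⟨ *-distribˡ-sum (f a * g b) (λ d → δ (a ⊕ b) d * φ d) ⟨
           f a * g b * (sum λ d → δ (a ⊕ b) d * φ d)    ≈⟨ *-congˡ (sum-δ (a ⊕ b) φ) ⟩
           f a * g b * φ (a ⊕ b)                        ∎) ⟩
    (sum λ a → sum λ b → f a * g b * φ (a ⊕ b)) ∎

  -- Multiplying by `h` and reading off the coefficient at `d` is a linear functional `φ`, to which
  -- `sum-*ᴬ` applies.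
  *ᴬ-triple : ∀ f g h d → ((f *ᴬ g) *ᴬ h) d ≈ sum λ a → sum λ b → sum λ c → f a * g b * h c * δ (a ⊕ b ⊕ c) d
  *ᴬ-triple f g h d = begin
    (sum λ e → sum λ c → (f *ᴬ g) e * h c * δ (e ⊕ c) d)
      ≈⟨ sum-cong-≋ (λ e → pull ((f *ᴬ g) e) e) ⟩
    (sum λ e → (f *ᴬ g) e * φ e)
      ≈⟨ sum-*ᴬ f g φ ⟩
    (sum λ a → sum λ b → f a * g b * φ (a ⊕ b))
      ≈⟨ sum-cong-≋ (λ a → sum-cong-≋ λ b → pull (f a * g b) (a ⊕ b)) ⟨
    (sum λ a → sum λ b → sum λ c → f a * g b * h c * δ (a ⊕ b ⊕ c) d) ∎
    where
    φ : A
    φ e = sum λ c → h c * δ (e ⊕ c) d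
    pull : ∀ s e → sum (λ c → s * h c * δ (e ⊕ c) d) ≈ s * φ e
    pull s e = trans (sum-cong-≋ λ c → *-assoc s (h c) (δ (e ⊕ c) d))
      (sym (*-distribˡ-sum s λ c → h c * δ (e ⊕ c) d))

  -- The triple sum is invariant under rotating the three factors, so (fg)h equals (gh)f, and
  -- commutativity finishes.
  *ᴬ-assoc : ∀ f g h → (f *ᴬ g) *ᴬ h ≈ᴬ f *ᴬ (g *ᴬ h)
  *ᴬ-assoc f g h d = begin
    ((f *ᴬ g) *ᴬ h) d
      ≈⟨ *ᴬ-triple f g h d ⟩
    (sum λ a → sum λ b → sum λ c → f a * g b * h c * δ (a ⊕ b ⊕ c) d)
      ≈⟨ sum-cong-≋ (λ a → sum-cong-≋ λ b → sum-cong-≋ λ c →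
           *-cong (trans (*-assoc (f a) (g b) (h c)) (*-comm (f a) _))
                  (reflexive (≡.cong (λ i → δ i d) (⊕-rotate a b c)))) ⟩
    (sum λ a → sum λ b → sum λ c → g b * h c * f a * δ (b ⊕ c ⊕ a) d)
      ≈⟨ ∑-comm (λ a b → sum λ c → g b * h c * f a * δ (b ⊕ c ⊕ a) d) ⟩
    (sum λ b → sum λ a → sum λ c → g b * h c * f a * δ (b ⊕ c ⊕ a) d)
      ≈⟨ sum-cong-≋ (λ b → ∑-comm λ a c → g b * h c * f a * δ (b ⊕ c ⊕ a) d) ⟩
    (sum λ b → sum λ c → sum λ a → g b * h c * f a * δ (b ⊕ c ⊕ a) d)
      ≈⟨ *ᴬ-triple g h f d ⟨
    ((g *ᴬ h) *ᴬ f) d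
      ≈⟨ *ᴬ-comm (g *ᴬ h) f d ⟩
    (f *ᴬ (g *ᴬ h)) d ∎

  *ᴬ-distribˡ : ∀ f g h → f *ᴬ (λ d → g d + h d) ≈ᴬ λ d → (f *ᴬ g) d + (f *ᴬ h) d
  *ᴬ-distribˡ f g h d = trans
    (sum-cong-≋ λ a → trans
      (sum-cong-≋ λ b → trans (*-congʳ (distribˡ (f a) (g b) (h b))) (distribʳ _ _ _))
      (∑-distrib-+ (λ b → f a * g b * δ (a ⊕ b) d) (λ b → f a * h b * δ (a ⊕ b) d)))
    (∑-distrib-+ (λ a → sum λ b → f a * g b * δ (a ⊕ b) d) (λ a → sum λ b → f a * h b * δ (a ⊕ b) d))

  monomial-*ᴬ : ∀ i c f d → (monomial i c *ᴬ f) d ≈ c * sum λ b → f b * δ ((i mod m) ⊕ b) d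
  monomial-*ᴬ i c f d = begin
    (sum λ a → sum λ b → c * δ (i mod m) a * f b * δ (a ⊕ b) d)
      ≈⟨ sum-cong-≋ (λ a → sum-cong-≋ λ b →
           trans (*-assoc (c * δ (i mod m) a) (f b) (δ (a ⊕ b) d)) (*-congʳ (*-comm c _))) ⟩
    (sum λ a → sum λ b → δ (i mod m) a * c * (f b * δ (a ⊕ b) d))
      ≈⟨ sum-cong-≋ (λ a → trans (sum-cong-≋ λ b → *-assoc (δ (i mod m) a) c (f b * δ (a ⊕ b) d))
           (sym (*-distribˡ-sum (δ (i mod m) a) λ b → c * (f b * δ (a ⊕ b) d)))) ⟩
    (sum λ a → δ (i mod m) a * sum λ b → c * (f b * δ (a ⊕ b) d))
      ≈⟨ sum-δ (i mod m) (λ a → sum λ b → c * (f b * δ (a ⊕ b) d)) ⟩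
    (sum λ b → c * (f b * δ ((i mod m) ⊕ b) d))
      ≈⟨ *-distribˡ-sum c (λ b → f b * δ ((i mod m) ⊕ b) d) ⟨
    (c * sum λ b → f b * δ ((i mod m) ⊕ b) d) ∎

  sum-δʳ : ∀ (f : A) d → sum (λ b → f b * δ b d) ≈ f d
  sum-δʳ f d = trans (sum-cong-≋ λ b → trans (*-comm (f b) (δ b d)) (*-congʳ (δ-sym b d))) (sum-δ d f)
    where
    δ-sym : ∀ (a b : Fin m) → δ a b ≈ δ b a
    δ-sym a b with a Fin.≟ b
    ... | yes a≡b = sym (δ-≡ (≡.sym a≡b))
    ... | no  a≢b = sym (δ-≢ (a≢b ∘ ≡.sym))

  constant-*ᴬ : ∀ c f → monomial 0 c *ᴬ f ≈ᴬ λ d → c * f d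
  constant-*ᴬ c f d = trans (monomial-*ᴬ 0 c f d) (*-congˡ (trans
    (sum-cong-≋ λ b → *-congˡ {f b} (reflexive (≡.cong (λ i → δ i d) (0⊕ b)))) (sum-δʳ f d)))

  -- Multiplication by x shifts coefficients up by one. Since `d` is not 0, the wrap-around from the
  -- top coefficient is not met.
  x-*ᴬ : ∀ f d e → toℕ d ≡ suc (toℕ e) → (monomial 1 1# *ᴬ f) d ≈ f e
  x-*ᴬ f d e d≡1+e = begin
    (monomial 1 1# *ᴬ f) d                       ≈⟨ monomial-*ᴬ 1 1# f d ⟩
    (1# * sum λ b → f b * δ ((1 mod m) ⊕ b) d)   ≈⟨ *-identityˡ _ ⟩
    (sum λ b → f b * δ ((1 mod m) ⊕ b) d)        ≈⟨ sum-cong-≋ (λ b → *-congˡ {f b} (δ-shift b)) ⟩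
    (sum λ b → f b * δ b e)                      ≈⟨ sum-δʳ f e ⟩
    f e                                          ∎
    where
    δ-shift : ∀ b → δ ((1 mod m) ⊕ b) d ≈ δ b e
    δ-shift b with b Fin.≟ e
    ... | no b≢e = δ-≢ (b≢e ∘ toℕ-injective ∘ 1⊕≡⇒ d≡1+e)
    ... | yes ≡.refl = δ-≡ (≡.trans (≡.cong ((1 mod m) ⊕_) (≡.sym (toℕ-mod-inverse e)))
        (≡.trans (mod-⊕ 1 (toℕ e)) (≡.trans (≡.cong (_mod m) (≡.sym d≡1+e)) (toℕ-mod-inverse d))))

  monomial-* : ∀ i j c d → monomial i c *ᴬ monomial j d ≈ᴬ monomial (i ℕ.+ j) (c * d)
  monomial-* i j c d e = begin
    (monomial i c *ᴬ monomial j d) e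
      ≈⟨ monomial-*ᴬ i c (monomial j d) e ⟩
    (c * sum λ b → d * δ (j mod m) b * δ ((i mod m) ⊕ b) e)
      ≈⟨ *-congˡ (sum-cong-≋ λ b → trans (*-congʳ (*-comm d _)) (*-assoc (δ (j mod m) b) d (δ ((i mod m) ⊕ b) e))) ⟩
    (c * sum λ b → δ (j mod m) b * (d * δ ((i mod m) ⊕ b) e))
      ≈⟨ *-congˡ (sum-δ (j mod m) λ b → d * δ ((i mod m) ⊕ b) e) ⟩
    c * (d * δ ((i mod m) ⊕ (j mod m)) e)
      ≈⟨ *-assoc c d _ ⟨
    c * d * δ ((i mod m) ⊕ (j mod m)) e
      ≈⟨ *-congˡ (reflexive (≡.cong (λ k → δ k e) (mod-⊕ i j))) ⟩
    c * d * δ ((i ℕ.+ j) mod m) e ∎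

  groupAlgebra : CommutativeRing 0ℓ 0ℓ
  groupAlgebra = record
    { Carrier = A
    ; _≈_     = _≈ᴬ_
    ; _+_     = λ f g d → f d + g d
    ; _*_     = _*ᴬ_
    ; -_      = λ f d → - f d
    ; 0#      = λ _ → 0#
    ; 1#      = monomial 0 1#
    ; isCommutativeRing = record
      { isRing = record
        { +-isAbelianGroup = record
          { isGroup = record
            { isMonoid = record
              { isSemigroup = record
                { isMagma = record
                  { isEquivalence = record
                    { refl  = λ d → refl
                    ; sym   = λ eq d → sym (eq d)
                    ; trans = λ eq₁ eq₂ d → trans (eq₁ d) (eq₂ d)
                    }
                  ; ∙-cong = λ f≈ g≈ d → +-cong (f≈ d) (g≈ d)
                  }
                ; assoc = λ f g h d → +-assoc (f d) (g d) (h d)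
                }
              ; identity = (λ f d → +-identityˡ (f d)) , (λ f d → +-identityʳ (f d))
              }
            ; inverse = (λ f d → -‿inverseˡ (f d)) , (λ f d → -‿inverseʳ (f d))
            ; ⁻¹-cong = λ f≈ d → -‿cong (f≈ d)
            }
          ; comm = λ f g d → +-comm (f d) (g d)
          }
        ; *-cong     = *ᴬ-cong
        ; *-assoc    = *ᴬ-assoc
        ; *-identity = *ᴬ-identityˡ , λ f d → trans (*ᴬ-comm f (monomial 0 1#) d) (*ᴬ-identityˡ f d)
        ; distrib    = *ᴬ-distribˡ , λ f g h d → trans (*ᴬ-comm (λ e → g e + h e) f d)
            (trans (*ᴬ-distribˡ f g h d) (+-cong (*ᴬ-comm f g d) (*ᴬ-comm f h d)))
        }
      ; *-comm = *ᴬ-comm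
      }
    }
    where
    *ᴬ-identityˡ : ∀ f → monomial 0 1# *ᴬ f ≈ᴬ f
    *ᴬ-identityˡ f d = trans (constant-*ᴬ 1# f d) (*-identityˡ (f d))

-- Finite rings with a^q = a, and their cyclic extensions.

record FrobeniusRing (p k : ℕ) : Set₁ where
  field
    commutativeRing : CommutativeRing 0ℓ 0ℓ
  open CommutativeRing commutativeRing public hiding (zero)
  open Algebra.Properties.Semiring.Exp semiring public using (_^_)
  field
    -- Decidable equality and a list complete up to `≈` make the search for a minimal idempotent in
    -- `refine` effective.
    _≟_       : ∀ a b → Dec (a ≈ b)
    elements  : List Carrier
    complete  : ∀ a → Any (a ≈_) elements
    char      : p ×1≈0-in commutativeRing
    frobenius : ∀ a → a ^ (p ℕ.^ k) ≈ a

module _ (R : CommutativeRing 0ℓ 0ℓ) where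
  open CommutativeRing R hiding (zero)

  allFunctions : List Carrier → ∀ n → List (Fin n → Carrier)
  allFunctions xs zero    = (λ ()) ∷ []
  allFunctions xs (suc n) = cartesianProductWith _◂_ xs (allFunctions xs n)

  allFunctions-complete : ∀ {xs} → (∀ a → Any (a ≈_) xs) → ∀ {n} (f : Fin n → Carrier) →
                          Any (λ g → ∀ i → f i ≈ g i) (allFunctions xs n)
  allFunctions-complete cmp {zero}  f = here λ ()
  allFunctions-complete {xs} cmp {suc n} f with find (cmp (f zero)) | find (allFunctions-complete cmp (f ∘ suc))
  ... | a , a∈ , f0≈a | g , g∈ , f≈g = Any.map (λ { ≡.refl → λ { zero → f0≈a ; (suc i) → f≈g i } })
    (∈-cartesianProductWith⁺ _◂_ a∈ g∈)

module Extension {p k m : ℕ} .{{_ : NonZero m}} (pr : Prime p) (q≡1+m : p ℕ.^ k ≡ suc m)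
                 (B : FrobeniusRing p k) where

  open FrobeniusRing B
  open Algebra.Properties.Semiring.Sum semiring using (sum; sum-cong-≋)
  open Algebra.Properties.Semiring.Mult semiring using () renaming (_×_ to _·_)
  open CyclicGroup m
  open GroupAlgebra commutativeRing m
  open Relation.Binary.Reasoning.Setoid setoid

  module S = CommutativeRing groupAlgebra
  module SE = Algebra.Properties.Semiring.Exp S.semiring
  module SM = Algebra.Properties.Semiring.Mult S.semiring
  module SS = Algebra.Properties.Semiring.Sum S.semiring
  module SC = Algebra.Properties.CommutativeSemigroup S.*-commutativeSemigroup

  x : A
  x = monomial 1 1#

  monomial-cong : ∀ {i j c d} → i % m ≡ j % m → c ≈ d → monomial i c ≈ᴬ monomial j d
  monomial-cong eq c≈d e = *-cong c≈d (reflexive (≡.cong (λ l → δ l e) (mod-≡ eq)))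

  monomial-^ : ∀ i c n → monomial i c SE.^ n ≈ᴬ monomial (n ℕ.* i) (c ^ n)
  monomial-^ i c zero    = S.refl
  monomial-^ i c (suc n) = S.trans (S.*-congˡ (monomial-^ i c n)) (monomial-* i (n ℕ.* i) c (c ^ n))

  sum-apply : ∀ {n} (F : Fin n → A) d → SS.sum F d ≈ sum (λ i → F i d)
  sum-apply {zero}  F d = refl
  sum-apply {suc n} F d = +-congˡ (sum-apply (F ∘ suc) d)

  ×-apply : ∀ n f d → (n SM.× f) d ≈ n · f d
  ×-apply zero    f d = refl
  ×-apply (suc n) f d = +-congˡ (×-apply n f d)

  expansion : ∀ f → f ≈ᴬ SS.sum λ i → monomial (toℕ i) (f i)
  expansion f d = sym (begin
    SS.sum (λ i → monomial (toℕ i) (f i)) d    ≈⟨ sum-apply (λ i → monomial (toℕ i) (f i)) d ⟩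
    (sum λ i → f i * δ (toℕ i mod m) d)        ≈⟨ sum-cong-≋ (λ i → *-congˡ {f i} (reflexive (≡.cong (λ j → δ j d) (toℕ-mod-inverse i)))) ⟩
    (sum λ i → f i * δ i d)                    ≈⟨ sum-δʳ f d ⟩
    f d                                        ∎)

  extension-char : p ×1≈0-in groupAlgebra
  extension-char d = trans (×-apply p (monomial 0 1#) d)
    (Frobenius.char∣⇒×≈0 commutativeRing p pr char ∣-refl _)

  -- The q-th power is additive, so monomials suffice. Their coefficients are fixed by the
  -- hypothesis on the base ring, their exponents because q ≡ 1 modulo `m`.
  extension-frobenius : ∀ f → f SE.^ (p ℕ.^ k) ≈ᴬ f
  extension-frobenius f = S.trans (SE.^-congˡ q (expansion f)) (S.trans
    (frobenius^-sum k λ i → monomial (toℕ i) (f i)) (S.trans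
    (SS.sum-cong-≋ λ i → S.trans (monomial-^ (toℕ i) (f i) q) (monomial-cong (q*i≡i (toℕ i)) (frobenius (f i))))
    (S.sym (expansion f))))
    where
    open Frobenius groupAlgebra p pr extension-char using (frobenius^-sum)
    q = p ℕ.^ k
    q*i≡i : ∀ i → (q ℕ.* i) % m ≡ i % m
    q*i≡i i = ≡.trans (≡.cong (_% m) (≡.trans (≡.cong (ℕ._* i) q≡1+m) (≡.cong (i ℕ.+_) (ℕ.*-comm m i)))) ([m+kn]%n≡m%n i i m)

  extension : FrobeniusRing p k
  extension = record
    { commutativeRing = groupAlgebra
    ; _≟_       = λ f g → all? λ d → f d ≟ g d
    ; elements  = allFunctions commutativeRing elements m
    ; complete  = allFunctions-complete commutativeRing complete
    ; char      = extension-char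
    ; frobenius = extension-frobenius
    }

  -- The product of `v` with all x - u_i. If `v` is the Vandermonde product of the old roots, this
  -- is the one for the list enlarged by x.
  linearProduct : Carrier → ∀ {j} → (Fin j → Carrier) → A
  linearProduct v {zero}  u = monomial 0 v
  linearProduct v {suc j} u = (x S.- monomial 0 (u zero)) *ᴬ linearProduct v (u ∘ suc)

  linear∣linearProduct : ∀ v {j} (u : Fin j → Carrier) i →
                         ∃ λ w → (x S.- monomial 0 (u i)) *ᴬ w ≈ᴬ linearProduct v u
  linear∣linearProduct v u zero = linearProduct v (u ∘ suc) , S.refl
  linear∣linearProduct v u (suc i) with linear∣linearProduct v (u ∘ suc) i
  ... | w , eq = (x S.- monomial 0 (u zero)) *ᴬ w , S.trans (SC.x∙yz≈y∙xz _ _ w) (S.*-congˡ eq)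

  constant∣linearProduct : ∀ v {j} (u : Fin j → Carrier) → ∃ λ w → monomial 0 v *ᴬ w ≈ᴬ linearProduct v u
  constant∣linearProduct v {zero} u = S.1# , S.*-identityʳ _
  constant∣linearProduct v {suc j} u with constant∣linearProduct v (u ∘ suc)
  ... | w , eq = (x S.- monomial 0 (u zero)) *ᴬ w , S.trans (SC.x∙yz≈y∙xz _ _ w) (S.*-congˡ eq)

  linear-coefficient : ∀ c f d e → toℕ d ≡ suc (toℕ e) → ((x S.- monomial 0 c) *ᴬ f) d ≈ f e - c * f d
  linear-coefficient c f d e eq = trans
    (SR.[y-z]x≈yx-zx f x (monomial 0 c) d)
    (+-cong (x-*ᴬ f d e eq) (-‿cong (constant-*ᴬ c f d)))
    where module SR = Algebra.Properties.Ring S.ring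

  -- The degree is at most `j`: by `linear-coefficient`, each linear factor raises it by at most
  -- one, and only coefficients at nonzero positions are read, so reduction modulo xᵐ - 1 does not
  -- interfere.
  linearProduct-above : ∀ v {j} (u : Fin j → Carrier) d → j < toℕ d → linearProduct v u d ≈ 0#
  -- Each linear factor is monic, so `v` is carried up unchanged; the other term of
  -- `linear-coefficient` vanishes by `linearProduct-above`.
  linearProduct-leading : ∀ v {j} (u : Fin j → Carrier) d → toℕ d ≡ j → linearProduct v u d ≈ v

  private
    pred : ∀ {j} (d : Fin m) → toℕ d ≡ suc j → ∃ λ e → toℕ e ≡ j
    pred d eq = fromℕ< (ℕ.<-trans (ℕ.≤-reflexive (≡.sym eq)) (toℕ<n d)) , toℕ-fromℕ< _

    x-c*0≈x : ∀ {a c b} → b ≈ 0# → a - c * b ≈ a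
    x-c*0≈x {a} {c} {b} b≈0 = begin
      a - c * b   ≈⟨ +-congˡ (-‿cong (trans (*-congˡ b≈0) (zeroʳ c))) ⟩
      a - 0#      ≈⟨ +-congˡ (Algebra.Properties.Ring.-0#≈0# ring) ⟩
      a + 0#      ≈⟨ +-identityʳ a ⟩
      a           ∎

  linearProduct-above v {zero} u d j<d = trans
    (*-congˡ (δ-≢ λ eq → ℕ.<⇒≢ j<d (≡.trans (≡.sym (≡.trans (toℕ-mod 0) (m*n%n≡0 0 m))) (≡.cong toℕ eq)))) (zeroʳ v)
  linearProduct-above v {suc j} u d j<d = step (toℕ d) ≡.refl j<d
    where
    step : ∀ n → toℕ d ≡ n → suc j < n → linearProduct v u d ≈ 0#
    step (suc n) d≡n (s≤s j<n) with pred d d≡n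
    ... | e , ≡.refl = trans (linear-coefficient (u zero) (linearProduct v (u ∘ suc)) d e d≡n)
      (trans (x-c*0≈x (linearProduct-above v (u ∘ suc) d (ℕ.<-trans (ℕ.n<1+n j) j<d)))
        (linearProduct-above v (u ∘ suc) e j<n))

  linearProduct-leading v {zero} u d d≡j = trans
    (*-congˡ (δ-≡ (≡.trans (mod-≡ (≡.cong (_% m) (≡.sym d≡j))) (toℕ-mod-inverse d)))) (*-identityʳ v)
  linearProduct-leading v {suc j} u d d≡j with pred d d≡j
  ... | e , ≡.refl = trans (linear-coefficient (u zero) (linearProduct v (u ∘ suc)) d e d≡j)
      (trans (x-c*0≈x (linearProduct-above v (u ∘ suc) d (ℕ.≤-reflexive (≡.sym d≡j))))
        (linearProduct-leading v (u ∘ suc) e ≡.refl))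

-- The element v plays the role of a Vandermonde determinant: as v ≉ 0, some
-- residue field of the ring keeps the roots of unity u i apart.
record RootsOfUnity (p k m j : ℕ) : Set₁ where
  field
    frobeniusRing : FrobeniusRing p k
  open FrobeniusRing frobeniusRing public
  field
    u     : Fin j → Carrier
    u^m≈1 : ∀ i → u i ^ m ≈ 1#
    v     : Carrier
    v≉0   : ¬ v ≈ 0#
    u-u∣v : ∀ {i l} → i ≢ l → ∃ λ w → (u i - u l) * w ≈ v

-- Adjoining roots of unity one at a time.

module _ {p k m : ℕ} .{{_ : NonZero m}} (pr : Prime p) (q≡1+m : p ℕ.^ k ≡ suc m) where

  adjoinRoot : ∀ {j} → j < m → RootsOfUnity p k m j → RootsOfUnity p k m (suc j)
  adjoinRoot {j} j<m T = record
    { frobeniusRing = extension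
    ; u     = u′
    ; u^m≈1 = u′^m≈1
    ; v     = linearProduct v u
    -- Position `j` exists because j < m, and the coefficient there is the old `v`.
    ; v≉0   = λ eq → v≉0 (trans (sym (linearProduct-leading v u (fromℕ< j<m) (toℕ-fromℕ< j<m))) (eq (fromℕ< j<m)))
    ; u-u∣v = u′-u′∣
    }
    where
    open RootsOfUnity T
    open Extension pr q≡1+m frobeniusRing
    open GroupAlgebra commutativeRing m
    open Algebra.Properties.Ring ring using ([y-z]x≈yx-zx)
    module SR = Algebra.Properties.Ring S.ring

    u′ : Fin (suc j) → A
    u′ zero    = x
    u′ (suc i) = monomial 0 (u i)

    u′^m≈1 : ∀ i → u′ i SE.^ m ≈ᴬ S.1#
    u′^m≈1 zero    = S.trans (monomial-^ 1 1# m) (monomial-cong m*1≡0 (1^n≈1 commutativeRing m))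
      where
      m*1≡0 : (m ℕ.* 1) % m ≡ 0 % m
      m*1≡0 = ≡.trans (≡.cong (_% m) (ℕ.*-comm m 1)) ([m+kn]%n≡m%n 0 1 m)
    u′^m≈1 (suc i) = S.trans (monomial-^ 0 (u i) m) (monomial-cong (≡.cong (_% m) (ℕ.*-zeroʳ m)) (u^m≈1 i))

    swap : ∀ {a b c} → (∃ λ w → (a S.- b) *ᴬ w ≈ᴬ c) → ∃ λ w → (b S.- a) *ᴬ w ≈ᴬ c
    swap {a} {b} {c} (w , eq) = S.- w , S.trans (S.sym (SR.-‿distribʳ-* (b S.- a) w))
      (S.trans (SR.-‿distribˡ-* (b S.- a) w) (S.trans (S.*-congʳ (SR.⁻¹-anti-homo‿- b a)) eq))

    u′-u′∣ : ∀ {i l} → i ≢ l → ∃ λ w → (u′ i S.- u′ l) *ᴬ w ≈ᴬ linearProduct v u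
    u′-u′∣ {zero}  {zero}  i≢l = contradiction ≡.refl i≢l
    u′-u′∣ {zero}  {suc l} i≢l = linear∣linearProduct v u l
    u′-u′∣ {suc i} {zero}  i≢l = swap (linear∣linearProduct v u i)
    -- For two old roots the difference divides the old `v`, which in turn divides the new element
    -- as a constant.
    u′-u′∣ {suc i} {suc l} i≢l with u-u∣v (i≢l ∘ ≡.cong suc) | constant∣linearProduct v u
    ... | w , eq | w′ , eq′ = monomial 0 w *ᴬ w′ , S.trans (S.sym (S.*-assoc _ (monomial 0 w) w′))
      (S.trans (S.*-congʳ (S.trans (S.*-congʳ {monomial 0 w} λ d → sym ([y-z]x≈yx-zx _ (u i) (u l)))
        (S.trans (monomial-* 0 0 (u i - u l) w) (monomial-cong {0} {0} ≡.refl eq)))) eq′)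

  adjoinRoots : RootsOfUnity p k m 0 → ∀ j → j ≤ m → RootsOfUnity p k m j
  adjoinRoots T zero    _   = T
  adjoinRoots T (suc j) j<m = adjoinRoot j<m (adjoinRoots T j (ℕ.<⇒≤ j<m))

-- Quotient rings and the prime field ℤ/p.

module _ (R : CommutativeRing 0ℓ 0ℓ) where
  open CommutativeRing R

  -- A quotient keeps carrier and operations and only coarsens equality. It yields both ℤ/p and the
  -- residue field.
  quotientRing : (_~_ : Carrier → Carrier → Set) → IsEquivalence _~_ → (∀ {a b} → a ≈ b → a ~ b) →
                 (∀ {a b c d} → a ~ b → c ~ d → (a + c) ~ (b + d)) →
                 (∀ {a b c d} → a ~ b → c ~ d → (a * c) ~ (b * d)) →
                 (∀ {a b} → a ~ b → (- a) ~ (- b)) → CommutativeRing 0ℓ 0ℓ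
  quotientRing _~_ ~-equiv ≈⇒~ ~-+ ~-* ~-neg = record
    { Carrier = Carrier
    ; _≈_     = _~_
    ; _+_     = _+_
    ; _*_     = _*_
    ; -_      = -_
    ; 0#      = 0#
    ; 1#      = 1#
    ; isCommutativeRing = record
      { isRing = record
        { +-isAbelianGroup = record
          { isGroup = record
            { isMonoid = record
              { isSemigroup = record
                { isMagma = record { isEquivalence = ~-equiv ; ∙-cong = ~-+ }
                ; assoc = λ a b c → ≈⇒~ (+-assoc a b c)
                }
              ; identity = (λ a → ≈⇒~ (+-identityˡ a)) , (λ a → ≈⇒~ (+-identityʳ a))
              }
            ; inverse = (λ a → ≈⇒~ (-‿inverseˡ a)) , (λ a → ≈⇒~ (-‿inverseʳ a))
            ; ⁻¹-cong = ~-neg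
            }
          ; comm = λ a b → ≈⇒~ (+-comm a b)
          }
        ; *-cong     = ~-*
        ; *-assoc    = λ a b c → ≈⇒~ (*-assoc a b c)
        ; *-identity = (λ a → ≈⇒~ (*-identityˡ a)) , (λ a → ≈⇒~ (*-identityʳ a))
        ; distrib    = (λ a b c → ≈⇒~ (distribˡ a b c)) , (λ a b c → ≈⇒~ (distribʳ a b c))
        }
      ; *-comm = λ a b → ≈⇒~ (*-comm a b)
      }
    }

module ModularIntegers (n : ℕ) where
  open import Data.Integer using (_+_; _*_; _-_; -_)
  open +-*-Solver

  infix 4 _~_

  _~_ : ℤ → ℤ → Set
  a ~ b = + n ℤ.∣ a - b

  ≡⇒~ : ∀ {a b} → a ≡ b → a ~ b
  ≡⇒~ {a} ≡.refl = ℤ.divides 0ℤ (≡.trans (ℤ.+-inverseʳ a) (≡.sym (ℤ.*-zeroˡ (+ n))))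

  ~-isEquivalence : IsEquivalence _~_
  ~-isEquivalence = record
    { refl  = λ {a} → ≡⇒~ {a} ≡.refl
    ; sym   = λ {a} {b} d → ≡.subst (+ n ℤ.∣_) (solve 2 (λ a b → :- (a :- b) := b :- a) ≡.refl a b) (ℤ.∣m⇒∣-m d)
    ; trans = λ {a} {b} {c} d e → ≡.subst (+ n ℤ.∣_)
        (solve 3 (λ a b c → (a :- b) :+ (b :- c) := a :- c) ≡.refl a b c) (ℤ.∣m∣n⇒∣m+n d e)
    }

  modularIntegers : CommutativeRing 0ℓ 0ℓ
  modularIntegers = quotientRing ℤ.+-*-commutativeRing _~_ ~-isEquivalence ≡⇒~
    (λ {a} {b} {c} {d} e f → ≡.subst (+ n ℤ.∣_)
      (solve 4 (λ a b c d → (a :- b) :+ (c :- d) := (a :+ c) :- (b :+ d)) ≡.refl a b c d) (ℤ.∣m∣n⇒∣m+n e f))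
    (λ {a} {b} {c} {d} e f → ≡.subst (+ n ℤ.∣_)
      (solve 4 (λ a b c d → (a :- b) :* c :+ b :* (c :- d) := (a :* c) :- (b :* d)) ≡.refl a b c d)
      (ℤ.∣m∣n⇒∣m+n (ℤ.∣m⇒∣m*n c e) (ℤ.∣n⇒∣m*n b f)))
    (λ {a} {b} e → ≡.subst (+ n ℤ.∣_)
      (solve 2 (λ a b → :- (a :- b) := :- a :- :- b) ≡.refl a b) (ℤ.∣m⇒∣-m e))

  remainder : .{{_ : NonZero n}} → ∀ a → a ~ + (a %ℕ n)
  remainder a = ℤ.divides (a /ℕ n) (≡.trans (≡.cong (_- + (a %ℕ n)) (a≡a%ℕn+[a/ℕn]*n a n))
    (solve 2 (λ x y → x :+ y :- x := y) ≡.refl (+ (a %ℕ n)) ((a /ℕ n) * + n)))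

module _ {p : ℕ} (pr : Prime p) (k : ℕ) where
  open ModularIntegers p
  open CommutativeRing modularIntegers hiding (zero)
  open Algebra.Properties.Semiring.Mult semiring using () renaming (_×_ to _·_)
  open Algebra.Properties.Semiring.Exp semiring using (_^_; ^-congˡ)
  open Relation.Binary.Reasoning.Setoid setoid

  private
    instance
      p≢0 : NonZero p
      p≢0 = prime⇒nonZero pr

    n·1≡n : ∀ n → n · 1ℤ ≡ + n
    n·1≡n zero    = ≡.refl
    n·1≡n (suc n) = ≡.cong ℤ.suc (n·1≡n n)

    p·1≈0 : p ×1≈0-in modularIntegers
    p·1≈0 = ≡.subst (λ a → + p ℤ.∣ a ℤ.- 0ℤ) (≡.sym (n·1≡n p))
      (≡.subst (+ p ℤ.∣_) (≡.sym (ℤ.+-identityʳ (+ p))) ℤ.∣-refl)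

    open Frobenius modularIntegers p pr p·1≈0

    q = p ℕ.^ k

    -- Fermat's little theorem by induction on `n`, from the additivity of the q-th power.
    fermat-ℕ : ∀ n → (+ n) ^ q ≈ + n
    fermat-ℕ zero    = 0^n≈0 modularIntegers q {{ℕ.m^n≢0 p k}}
    fermat-ℕ (suc n) = begin
      (1ℤ + + n) ^ q      ≈⟨ frobenius^-+ k 1ℤ (+ n) ⟩
      1ℤ ^ q + (+ n) ^ q  ≈⟨ +-cong {1ℤ ^ q} {1ℤ} {(+ n) ^ q} {+ n} (1^n≈1 modularIntegers q) (fermat-ℕ n) ⟩
      1ℤ + + n            ∎

    fermat : ∀ a → a ^ q ≈ a
    fermat a = begin
      a ^ q               ≈⟨ ^-congˡ q {a} {+ (a %ℕ p)} (remainder a) ⟩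
      (+ (a %ℕ p)) ^ q    ≈⟨ fermat-ℕ (a %ℕ p) ⟩
      + (a %ℕ p)          ≈⟨ remainder a ⟨
      a                   ∎

  primeField : FrobeniusRing p k
  primeField = record
    { commutativeRing = modularIntegers
    ; _≟_       = λ a b → + p ℤ.∣? a ℤ.- b
    ; elements  = map +_ (upTo p)
    ; complete  = λ a → lose (∈-map⁺ +_ (∈-upTo⁺ (n%ℕd<d a p))) (remainder a)
    ; char      = p·1≈0
    ; frobenius = fermat
    }

  noRoots : ∀ m → RootsOfUnity p k m 0
  noRoots m = record
    { frobeniusRing = primeField
    ; u     = λ ()
    ; u^m≈1 = λ ()
    ; v     = 1ℤ
    ; v≉0   = λ p∣1 → ¬prime[1] (≡.subst Prime (∣1⇒≡1 (ℤ.∣⇒∣ᵤ p∣1)) pr)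
    ; u-u∣v = λ {i} → contradiction i λ ()
    }

-- Bounding the number of roots of a polynomial function.

module Roots (R : CommutativeRing 0ℓ 0ℓ) where
  open CommutativeRing R hiding (zero)
  open Algebra.Properties.Ring ring
  open Algebra.Properties.Semiring.Exp semiring using (_^_)
  open Algebra.Properties.CommutativeSemigroup *-commutativeSemigroup using (x∙yz≈y∙xz)
  open Relation.Binary.Reasoning.Setoid setoid

  -- Polynomial functions of degree at most d whose coefficient at xᵈ is c,
  -- described through their divided differences.
  Polynomial : ℕ → Carrier → (Carrier → Carrier) → Set
  Polynomial zero    c f = ∀ x → f x ≈ c
  Polynomial (suc d) c f = ∀ r → ∃ λ g → Polynomial d c g × (∀ x → f x ≈ f r + (x - r) * g x)

  private
    x-r*0 : ∀ {a b} s → a ≈ b → a ≈ b + s * 0#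
    x-r*0 s eq = trans eq (sym (trans (+-congˡ (zeroʳ s)) (+-identityʳ _)))

  Polynomial-cong : ∀ d {c c′ f} → c ≈ c′ → Polynomial d c f → Polynomial d c′ f
  Polynomial-cong zero    c≈ P x = trans (P x) c≈
  Polynomial-cong (suc d) c≈ P r with P r
  ... | g , Pg , eq = g , Polynomial-cong d c≈ Pg , eq

  Polynomial-raise : ∀ d {c f} → Polynomial d c f → Polynomial (suc d) 0# f
  Polynomial-raise zero    P r = (λ _ → 0#) , (λ _ → refl) , λ x → x-r*0 (x - r) (trans (P x) (sym (P r)))
  Polynomial-raise (suc d) P r with P r
  ... | g , Pg , eq = g , Polynomial-raise d Pg , eq

  Polynomial-+ : ∀ d {c c′ f f′} → Polynomial d c f → Polynomial d c′ f′ → Polynomial d (c + c′) (λ x → f x + f′ x)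
  Polynomial-+ zero    P P′ x = +-cong (P x) (P′ x)
  Polynomial-+ (suc d) {f = f} {f′} P P′ r with P r | P′ r
  ... | g , Pg , eq | g′ , Pg′ , eq′ = (λ x → g x + g′ x) , Polynomial-+ d Pg Pg′ , λ x → begin
    f x + f′ x                                            ≈⟨ +-cong (eq x) (eq′ x) ⟩
    (f r + (x - r) * g x) + (f′ r + (x - r) * g′ x)       ≈⟨ +-CS.interchange _ _ _ _ ⟩
    (f r + f′ r) + ((x - r) * g x + (x - r) * g′ x)       ≈⟨ +-congˡ (distribˡ _ _ _) ⟨
    (f r + f′ r) + (x - r) * (g x + g′ x)                 ∎
    where module +-CS = Algebra.Properties.CommutativeSemigroup +-commutativeSemigroup

  Polynomial-scale : ∀ d {c f} s → Polynomial d c f → Polynomial d (s * c) (λ x → s * f x)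
  Polynomial-scale zero    s P x = *-congˡ (P x)
  Polynomial-scale (suc d) {f = f} s P r with P r
  ... | g , Pg , eq = (λ x → s * g x) , Polynomial-scale d s Pg , λ x → begin
    s * f x                           ≈⟨ *-congˡ (eq x) ⟩
    s * (f r + (x - r) * g x)         ≈⟨ distribˡ _ _ _ ⟩
    s * f r + s * ((x - r) * g x)     ≈⟨ +-congˡ (x∙yz≈y∙xz _ _ _) ⟩
    s * f r + (x - r) * (s * g x)     ∎

  -- The divided difference of x f(x) at `r` is f(x) + r g(x), with `g` that of `f`. Raising `P`
  -- first presents `g` in formal degree `d` with leading coefficient 0, so the sum keeps the
  -- coefficient `c`.
  Polynomial-x* : ∀ d {c f} → Polynomial d c f → Polynomial (suc d) c (λ x → x * f x)
  Polynomial-x* d {c} {f} P r with Polynomial-raise d P r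
  ... | g , Pg , eq = (λ x → f x + r * g x)
      , Polynomial-cong d (trans (+-congˡ (zeroʳ r)) (+-identityʳ c)) (Polynomial-+ d P (Polynomial-scale d r Pg))
      , λ x → sym (begin
    r * f r + (x - r) * (f x + r * g x)                 ≈⟨ +-congˡ (distribˡ _ _ _) ⟩
    r * f r + ((x - r) * f x + (x - r) * (r * g x))     ≈⟨ +-congˡ (+-comm _ _) ⟩
    r * f r + ((x - r) * (r * g x) + (x - r) * f x)     ≈⟨ +-assoc _ _ _ ⟨
    r * f r + (x - r) * (r * g x) + (x - r) * f x       ≈⟨ +-congʳ (+-congˡ (x∙yz≈y∙xz _ _ _)) ⟩
    r * f r + r * ((x - r) * g x) + (x - r) * f x       ≈⟨ +-congʳ (distribˡ _ _ _) ⟨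
    r * (f r + (x - r) * g x) + (x - r) * f x           ≈⟨ +-congʳ (*-congˡ (eq x)) ⟨
    r * f x + (x - r) * f x                             ≈⟨ distribʳ _ _ _ ⟨
    (r + (x - r)) * f x                                 ≈⟨ *-congʳ (trans (+-comm _ _) (//-rightDividesˡ r x)) ⟩
    x * f x                                             ∎)

  Polynomial-^ : ∀ n → Polynomial n 1# (_^ n)
  Polynomial-^ zero    x = refl
  Polynomial-^ (suc n) = Polynomial-x* n (Polynomial-^ n)

  module _ (1≉0 : ¬ 1# ≈ 0#) (*-cancel-0 : ∀ {a b} → ¬ a ≈ 0# → a * b ≈ 0# → b ≈ 0#) where

    -- Factor theorem: after dividing at the first root, the quotient vanishes at all the others
    -- because the differences of roots cancel. In degree 0 this leaves 1 ≈ 0.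
    Polynomial-roots : ∀ d {f} → Polynomial d 1# f → (a : Fin (suc d) → Carrier) →
                        (∀ {i j} → a i ≈ a j → i ≡ j) → ¬ (∀ i → f (a i) ≈ 0#)
    Polynomial-roots zero    P a a-inj fa≈0 = 1≉0 (trans (sym (P (a zero))) (fa≈0 zero))
    Polynomial-roots (suc d) {f} P a a-inj fa≈0 with P (a zero)
    ... | g , Pg , eq = Polynomial-roots d Pg (a ∘ suc) (suc-injective ∘ a-inj) λ i →
      *-cancel-0 (λ ai-a0≈0 → contradiction (a-inj (x∙y⁻¹≈ε⇒x≈y _ _ ai-a0≈0)) λ ()) (begin
        (a (suc i) - a zero) * g (a (suc i))               ≈⟨ +-identityˡ _ ⟨
        0# + (a (suc i) - a zero) * g (a (suc i))          ≈⟨ +-congʳ (fa≈0 zero) ⟨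
        f (a zero) + (a (suc i) - a zero) * g (a (suc i))  ≈⟨ eq (a (suc i)) ⟨
        f (a (suc i))                                      ≈⟨ fa≈0 (suc i) ⟩
        0#                                                 ∎)

    rootsOfUnity-bound : ∀ m .{{_ : NonZero m}} → (a : Fin (suc m) → Carrier) →
                         (∀ {i j} → a i ≈ a j → i ≡ j) → ¬ (∀ i → a i ^ m ≈ 1#)
    rootsOfUnity-bound (suc m) a a-inj a^m≈1 = Polynomial-roots (suc m) shifted a a-inj λ i →
      trans (+-congʳ (a^m≈1 i)) (-‿inverseʳ 1#)
      where
      -- Subtracting a constant leaves the divided difference `g` unchanged.
      shifted : Polynomial (suc m) 1# (λ x → x ^ suc m - 1#)
      shifted r with Polynomial-^ (suc m) r
      ... | g , Pg , eq = g , Pg , λ x → begin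
        x ^ suc m - 1#                            ≈⟨ +-congʳ (eq x) ⟩
        r ^ suc m + (x - r) * g x - 1#            ≈⟨ +-assoc _ _ _ ⟩
        r ^ suc m + ((x - r) * g x - 1#)          ≈⟨ +-congˡ (+-comm _ _) ⟩
        r ^ suc m + (- 1# + (x - r) * g x)        ≈⟨ +-assoc _ _ _ ⟨
        r ^ suc m - 1# + (x - r) * g x            ∎

-- The residue field at a minimal idempotent.

module ResidueField {p k m : ℕ} .{{_ : NonZero m}} (q≡1+m : p ℕ.^ k ≡ suc m) (T : RootsOfUnity p k m m) where
  open RootsOfUnity T
  open Algebra.Properties.Ring ring
  open Algebra.Properties.Semiring.Exp semiring using (^-congˡ; ^-congʳ)
  open Algebra.Properties.CommutativeSemigroup *-commutativeSemigroup using (x∙yz≈y∙xz; xy∙z≈xz∙y; xy∙z≈y∙xz; interchange)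
  open Relation.Binary.Reasoning.Setoid setoid

  a^m*a≈a : ∀ a → a ^ m * a ≈ a
  a^m*a≈a a = trans (*-comm _ _) (trans (^-congʳ a (≡.sym q≡1+m)) (frobenius a))

  -- As m + 1 = q, multiplication by aᵐ fixes `a`. It then fixes every multiple of `a`, and aᵐ is
  -- one because m ≥ 1.
  ^m-idempotent : ∀ a → a ^ m * a ^ m ≈ a ^ m
  ^m-idempotent a = go m ≡.refl
    where
    go : ∀ n → n ≡ m → a ^ m * a ^ n ≈ a ^ n
    go zero    0≡m = contradiction (≡.sym 0≡m) (ℕ.≢-nonZero⁻¹ m)
    go (suc n) _   = trans (sym (*-assoc _ _ _)) (*-congʳ (a^m*a≈a a))

  -- A nonzero `e′` below `e` that no idempotent aᵐ with `a` in the list can split further.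
  Refinement : Carrier → List Carrier → Set
  Refinement e as = ∃ λ e′ → ¬ e′ ≈ 0# × e * e′ ≈ e′ × All (λ a → e′ * a ^ m ≈ 0# ⊎ e′ * a ^ m ≈ e′) as

  -- Greedy descent: replace `e` by e · aᵐ whenever that is nonzero. The alternative settled for `a`
  -- survives later steps, since the final `e′` is a multiple of the element current at that moment.
  refine : ∀ e → ¬ e ≈ 0# → e * e ≈ e → ∀ as → Refinement e as
  refine e e≉0 ee≈e [] = e , e≉0 , ee≈e , []
  refine e e≉0 ee≈e (a ∷ as) with (e * a ^ m) ≟ 0#
  ... | yes ea≈0 with refine e e≉0 ee≈e as
  ...   | e′ , e′≉0 , ee′≈e′ , dich = e′ , e′≉0 , ee′≈e′ , inj₁ (begin
    e′ * a ^ m         ≈⟨ *-congʳ ee′≈e′ ⟨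
    e * e′ * a ^ m     ≈⟨ xy∙z≈y∙xz _ _ _ ⟩
    e′ * (e * a ^ m)   ≈⟨ *-congˡ ea≈0 ⟩
    e′ * 0#            ≈⟨ zeroʳ e′ ⟩
    0#                 ∎) ∷ dich
  refine e e≉0 ee≈e (a ∷ as) | no ea≉0
    with refine (e * a ^ m) ea≉0 (trans (interchange _ _ _ _) (*-cong ee≈e (^m-idempotent a))) as
  ...   | e′ , e′≉0 , eae′≈e′ , dich = e′ , e′≉0
    , (begin
        e * e′                  ≈⟨ *-congˡ eae′≈e′ ⟨
        e * (e * a ^ m * e′)    ≈⟨ *-assoc _ _ _ ⟨
        e * (e * a ^ m) * e′    ≈⟨ *-congʳ (trans (sym (*-assoc _ _ _)) (*-congʳ ee≈e)) ⟩
        e * a ^ m * e′          ≈⟨ eae′≈e′ ⟩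
        e′                      ∎)
    , inj₂ (begin
        e′ * a ^ m                 ≈⟨ *-congʳ eae′≈e′ ⟨
        e * a ^ m * e′ * a ^ m     ≈⟨ xy∙z≈xz∙y _ _ _ ⟩
        e * a ^ m * a ^ m * e′     ≈⟨ *-congʳ (trans (*-assoc _ _ _) (*-congˡ (^m-idempotent a))) ⟩
        e * a ^ m * e′             ≈⟨ eae′≈e′ ⟩
        e′                         ∎) ∷ dich

  private
    v^m≉0 : ¬ v ^ m ≈ 0#
    v^m≉0 eq = v≉0 (trans (sym (a^m*a≈a v)) (trans (*-congʳ eq) (zeroˡ v)))

    minimal : Refinement (v ^ m) elements
    minimal = refine (v ^ m) v^m≉0 (^m-idempotent v) elements

  e : Carrier
  e = proj₁ minimal

  e≉0 : ¬ e ≈ 0#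
  e≉0 = proj₁ (proj₂ minimal)

  v^m*e≈e : v ^ m * e ≈ e
  v^m*e≈e = proj₁ (proj₂ (proj₂ minimal))

  dichotomy : ∀ a → e * a ^ m ≈ 0# ⊎ e * a ^ m ≈ e
  dichotomy a with find (complete a)
  ... | b , b∈ , a≈b with All.lookup (proj₂ (proj₂ (proj₂ minimal))) b∈
  ...   | inj₁ eq = inj₁ (trans (*-congˡ (^-congˡ m a≈b)) eq)
  ...   | inj₂ eq = inj₂ (trans (*-congˡ (^-congˡ m a≈b)) eq)

  infix 4 _~_

  -- Congruence modulo the annihilator of `e`; the quotient is the ideal generated by `e`, with `e`
  -- acting as the identity.
  _~_ : Carrier → Carrier → Set
  a ~ b = e * a ≈ e * b

  residueRing : CommutativeRing 0ℓ 0ℓ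
  residueRing = quotientRing commutativeRing _~_
    (record { refl = refl ; sym = sym ; trans = trans }) *-congˡ
    (λ a~b c~d → trans (distribˡ _ _ _) (trans (+-cong a~b c~d) (sym (distribˡ _ _ _))))
    (λ {a} {b} {c} {d} a~b c~d → begin
      e * (a * c)  ≈⟨ *-assoc _ _ _ ⟨
      e * a * c    ≈⟨ *-congʳ a~b ⟩
      e * b * c    ≈⟨ xy∙z≈y∙xz _ _ _ ⟩
      b * (e * c)  ≈⟨ *-congˡ c~d ⟩
      b * (e * d)  ≈⟨ x∙yz≈y∙xz _ _ _ ⟩
      e * (b * d)  ∎)
    (λ a~b → trans (sym (-‿distribʳ-* _ _)) (trans (-‿cong a~b) (-‿distribʳ-* _ _)))

  private
    module F where
      open CommutativeRing residueRing public
      open Algebra.Properties.Semiring.Exp (CommutativeRing.semiring residueRing) public using (_^_)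

  0≁1 : ¬ 0# ~ 1#
  0≁1 eq = e≉0 (trans (sym (*-identityʳ e)) (trans (sym eq) (zeroʳ e)))

  -- If e · aᵐ were 0, then so would be e · a = e · aᵐ · a; `dichotomy` leaves only the other case.
  ^m~1 : ∀ a → ¬ a ~ 0# → a ^ m ~ 1#
  ^m~1 a a≁0 with dichotomy a
  ... | inj₂ eq = trans eq (sym (*-identityʳ e))
  ... | inj₁ eq = contradiction (begin
    e * a            ≈⟨ *-congˡ (a^m*a≈a a) ⟨
    e * (a ^ m * a)  ≈⟨ *-assoc _ _ _ ⟨
    e * a ^ m * a    ≈⟨ *-congʳ eq ⟩
    0# * a           ≈⟨ zeroˡ a ⟩
    0#               ≈⟨ zeroʳ e ⟨
    e * 0#           ∎) a≁0

  ~0⇒^m~0 : ∀ {a} → a ~ 0# → a ^ m ~ 0#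
  ~0⇒^m~0 {a} a~0 = go m ≡.refl
    where
    go : ∀ n → n ≡ m → a ^ n ~ 0#
    go zero    0≡m = contradiction (≡.sym 0≡m) (ℕ.≢-nonZero⁻¹ m)
    go (suc n) _   = F.trans {a ^ suc n} {0# * a ^ n} (F.*-congʳ {a ^ n} {a} {0#} a~0) (F.zeroˡ (a ^ n))

  u≁0 : ∀ i → ¬ u i ~ 0#
  u≁0 i ui~0 = 0≁1 (trans (sym (~0⇒^m~0 ui~0)) (*-congˡ (u^m≈1 i)))

  -- The descent started at vᵐ, so vᵐ fixes `e` and cannot annihilate it.
  v≁0 : ¬ v ~ 0#
  v≁0 v~0 = e≉0 (begin
    e          ≈⟨ v^m*e≈e ⟨
    v ^ m * e  ≈⟨ *-comm _ _ ⟩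
    e * v ^ m  ≈⟨ ~0⇒^m~0 v~0 ⟩
    e * 0#     ≈⟨ zeroʳ e ⟩
    0#         ∎)

  -- The difference of two distinct roots divides `v`, so its vanishing would make `v` vanish as
  -- well.
  u-injective : ∀ {i l} → u i ~ u l → i ≡ l
  u-injective {i} {l} ui~ul with i Fin.≟ l
  ... | yes i≡l = i≡l
  ... | no  i≢l with u-u∣v i≢l
  ...   | w , eq = contradiction (begin
    e * v                    ≈⟨ *-congˡ eq ⟨
    e * ((u i - u l) * w)    ≈⟨ *-assoc _ _ _ ⟨
    e * (u i - u l) * w      ≈⟨ *-congʳ (F.trans {u i - u l} {u l - u l} (F.+-congʳ { - u l} {u i} {u l} ui~ul) (F.-‿inverseʳ (u l))) ⟩
    e * 0# * w               ≈⟨ *-assoc _ _ _ ⟩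
    e * (0# * w)             ≈⟨ *-congˡ (zeroˡ w) ⟩
    e * 0#                   ∎) v≁0

  inverse : ∀ a → ¬ a ~ 0# → ∃ λ b → b * a ~ 1#
  inverse a a≁0 = go m ≡.refl
    where
    go : ∀ n → n ≡ m → ∃ λ b → b * a ~ 1#
    go zero    0≡m    = contradiction (≡.sym 0≡m) (ℕ.≢-nonZero⁻¹ m)
    go (suc n) ≡.refl = a ^ n , trans (*-congˡ (*-comm (a ^ n) a)) (^m~1 a a≁0)

  *-cancel-~0 : ∀ {a b} → ¬ a ~ 0# → a * b ~ 0# → b ~ 0#
  *-cancel-~0 {a} {b} a≁0 ab~0 with inverse a a≁0
  ... | c , ca~1 = begin
    e * b              ≈⟨ *-congˡ (*-identityˡ b) ⟨
    e * (1# * b)       ≈⟨ F.*-congʳ {b} {c * a} {1#} ca~1 ⟨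
    e * (c * a * b)    ≈⟨ *-congˡ (*-assoc c a b) ⟩
    e * (c * (a * b))  ≈⟨ F.*-congˡ {c} {a * b} {0#} ab~0 ⟩
    e * (c * 0#)       ≈⟨ *-congˡ (zeroʳ c) ⟩
    e * 0#             ∎

  elt : Fin (suc m) → Carrier
  elt zero    = 0#
  elt (suc i) = u i

  elt-injective : ∀ {i l} → elt i ~ elt l → i ≡ l
  elt-injective {zero}  {zero}  _  = ≡.refl
  elt-injective {zero}  {suc l} eq = contradiction (sym eq) (u≁0 l)
  elt-injective {suc i} {zero}  eq = contradiction eq (u≁0 i)
  elt-injective {suc i} {suc l} eq = ≡.cong suc (u-injective eq)

  -- A nonzero class outside the list would be, together with the `m` classes u_i, one root too many
  -- for xᵐ - 1.
  elt-surjective : ∀ a → ∃ λ i → elt i ~ a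
  elt-surjective a with (e * a) ≟ (e * 0#)
  ... | yes a~0 = zero , sym a~0
  ... | no  a≁0 with any? (λ i → (e * u i) ≟ (e * a))
  ...   | yes (i , ui~a) = suc i , ui~a
  ...   | no  u≁a = contradiction roots (Roots.rootsOfUnity-bound residueRing (0≁1 ∘ sym)
            (λ {b} {c} → *-cancel-~0 {b} {c}) m points points-injective)
    where
    points : Fin (suc m) → Carrier
    points zero    = a
    points (suc i) = u i
    points-injective : ∀ {i l} → points i ~ points l → i ≡ l
    points-injective {zero}  {zero}  _  = ≡.refl
    points-injective {zero}  {suc l} eq = contradiction (l , sym eq) u≁a
    points-injective {suc i} {zero}  eq = contradiction (i , eq) u≁a
    points-injective {suc i} {suc l} eq = ≡.cong suc (u-injective eq)
    power : ∀ b n → b F.^ n ≡ b ^ n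
    power b zero    = ≡.refl
    power b (suc n) = ≡.cong (b *_) (power b n)
    roots : ∀ i → points i F.^ m ~ 1#
    roots zero    = trans (*-congˡ (reflexive (power a m))) (^m~1 a a≁0)
    roots (suc i) = *-congˡ (trans (reflexive (power (u i) m)) (u^m≈1 i))

  residueField : FiniteField (suc m)
  residueField = record
    { commutativeRing = residueRing
    ; 0≉1           = 0≁1
    ; inverse       = inverse
    ; elt           = elt
    ; elt-injective = elt-injective
    ; index         = proj₁ ∘ elt-surjective
    ; elt-index     = proj₂ ∘ elt-surjective
    }

-- Assembling the fields and the code.

primePowerSystem : ∀ p k → Prime p → 1 ≤ k → AffineSystem (p ℕ.^ k ∸ 2) (Fin (p ℕ.^ k))
primePowerSystem p k@(suc k′) pr _ = go (p ℕ.^ k) ≡.refl 2≤q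
  where
  2≤q : 2 ≤ p ℕ.^ k
  2≤q = ℕ.≤-trans (prime>1 pr) (ℕ.m≤m*n p (p ℕ.^ k′) {{ℕ.m^n≢0 p k′ {{prime⇒nonZero pr}}}})
  go : ∀ q → p ℕ.^ k ≡ q → 2 ≤ q → AffineSystem (q ∸ 2) (Fin q)
  -- With q = r + 2, the nonzero elements are the m = r + 1 roots of unity adjoined to ℤ/p.
  go (suc (suc r)) q≡ _ = fieldSystem
    (ResidueField.residueField q≡ (adjoinRoots pr q≡ (noRoots pr k (suc r)) (suc r) ℕ.≤-refl))
  go (suc zero) _ (s≤s ())

theorem2p6 : (n : ℕ) → 2 ≤ n → (q : ℕ) → IsMinPrimePowerFactor q n →
    Σ (List (Permutation′ n)) λ C → IsRIPC (q ∸ 2) n C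
theorem2p6 n 2≤n q (_ , q-min) = code S , code-isRIPC S
  where
  S : AffineSystem (q ∸ 2) (Fin n)
  -- Minimality of `q` guarantees at least q - 2 slopes in every factor.
  S = affineSystem primePowerSystem (q ∸ 2) n (ℕ.<⇒≤ 2≤n) λ q′ q′-factor → ℕ.∸-monoˡ-≤ 2 (q-min q′ q′-factor)
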